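{- For any total Solovay test of randomness $\mathcal T=\{x_n:n=1,2,\dots\}$ there exists a computable unbounded function $\sigma(n)$ such that for every infinite binary sequence $\omega$: if there is a constant $c$ with $Km(\omega^n)\ge n-\sigma(n)-c$ for all $n$, then $\omega$ passes the test $\mathcal T$.
   Context: For an infinite binary sequence $\omega=\omega_1\omega_2\dots$, $\omega^n=\omega_1\dots\omega_n$; $l(x)$ is the length of a string $x$; $x\subseteq y$ means $x$ is a prefix of $y$. A Solovay test of randomness is a computable sequence $\{x_n\}$ of binary strings such that $\sum_n 2^{ -l(x_n)}$ converges; it is total if this series converges with a computable rate of convergence, i.e., there is a computable $m(\delta)$ with $\sum_{i\ge m(\delta)}2^{ -l(x_i)}\le\delta$ for every positive rational $\delta$. An infinite sequence $\omega$ passes the test if $x_n\not\subseteq\omega$ for almost all $n$. $Km$ denotes monotone Kolmogorov complexity: a monotone computable decoder is given by a recursively enumerable set $\hat\psi$ of pairs of strings such that if $(x,y),(x',y')\in\hat\psi$ and $x\subseteq x'$ then $y,y'$ are comparable, and $(x,y)\in\hat\psi$ implies $(x,y')\in\hat\psi$ for all $y'\subseteq y$; it defines $\psi(p)=\sup\{y:\exists p'\subseteq p,\ (p',y)\in\hat\psi\}$ and $Km_\psi(x)=\min\{l(p):x\subseteq\psi(p)\}$. $Km(x)=Km_\psi(x)$ for a fixed optimal $\psi$, i.e., one with $Km_\psi(x)\le Km_{\psi'}(x)+O(1)$ for every monotone computable $\psi'$. -}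

module Defs where

open import Data.Nat using (ℕ; zero; suc; _+_; _*_; _≤_; _<_)
open import Data.Fin using (Fin)
open import Data.Vec using (Vec; []; _∷_; lookup)
open import Data.Bool using (Bool; true; false)
open import Data.List using (List; []; _∷_; length)
open import Data.Product using (Σ; ∃; _×_; _,_)
open import Data.Empty using (⊥)
open import Data.Sum using (_⊎_)
open import Data.Integer using (+_)
open import Data.Rational using (ℚ; 1ℚ; 0ℚ; _/_) renaming (_*_ to _*ℚ_; _+_ to _+ℚ_; _≤_ to _≤ℚ_)
open import Relation.Nullary using (¬_)
open import Relation.Binary.PropositionalEquality using (_≡_)

data PR : ℕ → Set where
  zer  : ∀ {n} → PR n
  succ : PR 1
  proj : ∀ {n} → Fin n → PR n
  comp : ∀ {m n} → PR m → Vec (PR n) m → PR n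
  prec : ∀ {n} → PR n → PR (suc (suc n)) → PR (suc n)
  mu   : ∀ {n} → PR (suc n) → PR n

mutual
  data _[_]⇓_ : ∀ {n} → PR n → Vec ℕ n → ℕ → Set where
    ev-zer  : ∀ {n} {xs : Vec ℕ n} → zer [ xs ]⇓ 0
    ev-succ : ∀ {x} → succ [ x ∷ [] ]⇓ suc x
    ev-proj : ∀ {n} {i : Fin n} {xs} → proj i [ xs ]⇓ lookup xs i
    ev-comp : ∀ {m n} {f : PR m} {gs : Vec (PR n) m} {xs ys v} →
              gs [ xs ]⇓* ys → f [ ys ]⇓ v → comp f gs [ xs ]⇓ v
    ev-prec0 : ∀ {n} {g : PR n} {h} {xs v} →
               g [ xs ]⇓ v → prec g h [ 0 ∷ xs ]⇓ v
    ev-precS : ∀ {n} {g : PR n} {h} {k xs r v} →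
               prec g h [ k ∷ xs ]⇓ r → h [ k ∷ r ∷ xs ]⇓ v →
               prec g h [ suc k ∷ xs ]⇓ v
    ev-mu   : ∀ {n} {f : PR (suc n)} {xs k} →
              f [ k ∷ xs ]⇓ 0 →
              (∀ j → j < k → Σ ℕ λ v → f [ j ∷ xs ]⇓ suc v) →
              mu f [ xs ]⇓ k

  data _[_]⇓*_ : ∀ {m n} → Vec (PR n) m → Vec ℕ n → Vec ℕ m → Set where
    ev-[] : ∀ {n} {xs : Vec ℕ n} → [] [ xs ]⇓* []
    ev-∷  : ∀ {m n} {g : PR n} {gs : Vec (PR n) m} {xs y ys} →
            g [ xs ]⇓ y → gs [ xs ]⇓* ys → (g ∷ gs) [ xs ]⇓* (y ∷ ys)

Computable₁ : (ℕ → ℕ) → Set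
Computable₁ f = Σ (PR 1) λ c → ∀ n → c [ n ∷ [] ]⇓ f n

Computable₂ : (ℕ → ℕ → ℕ) → Set
Computable₂ f = Σ (PR 2) λ c → ∀ a b → c [ a ∷ b ∷ [] ]⇓ f a b

Str : Set
Str = List Bool

Seq : Set
Seq = ℕ → Bool

encode : Str → ℕ
encode []          = 0
encode (false ∷ s) = suc (2 * encode s)
encode (true ∷ s)  = suc (suc (2 * encode s))

tri : ℕ → ℕ
tri zero    = 0
tri (suc n) = suc n + tri n

pair : ℕ → ℕ → ℕ
pair a b = tri (a + b) + b

data _⊑_ : Str → Str → Set where
  []⊑ : ∀ {y} → [] ⊑ y
  ∷⊑  : ∀ {b x y} → x ⊑ y → (b ∷ x) ⊑ (b ∷ y)

data _⊑ω_ : Str → Seq → Set where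
  []⊑ω : ∀ {ω} → [] ⊑ω ω
  ∷⊑ω  : ∀ {x ω} → x ⊑ω (λ n → ω (suc n)) → (ω 0 ∷ x) ⊑ω ω

prefix : Seq → ℕ → Str
prefix ω zero    = []
prefix ω (suc n) = ω 0 ∷ prefix (λ k → ω (suc k)) n

Comparable : Str → Str → Set
Comparable x y = (x ⊑ y) ⊎ (y ⊑ x)

-- Monotone computable decoders: r.e. sets of pairs of strings,
-- presented as the halting domain of a code (an r.e. set of codes).

_∈D_ : Str × Str → PR 1 → Set
(x , y) ∈D d = Σ ℕ λ v → d [ pair (encode x) (encode y) ∷ [] ]⇓ v

record MonotoneDecoder : Set where
  field
    code       : PR 1
    consistent : ∀ {x y x′ y′} → (x , y) ∈D code → (x′ , y′) ∈D code →
                 x ⊑ x′ → Comparable y y′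
    downward   : ∀ {x y y′} → (x , y) ∈D code → y′ ⊑ y → (x , y′) ∈D code
open MonotoneDecoder public

-- x ⊑ ψ(p), where ψ(p) = sup { y : ∃ p′ ⊑ p, (p′ , y) ∈ ψ̂ }
_⊑out[_]_ : Str → MonotoneDecoder → Str → Set
x ⊑out[ ψ ] p = Σ Str λ p′ → Σ Str λ y →
                  (p′ ⊑ p) × ((p′ , y) ∈D code ψ) × (x ⊑ y)

-- KmLe ψ x k  ⟺  Km_ψ(x) ≤ k   (Km_ψ(x) = min { l(p) : x ⊑ ψ(p) })
KmLe : MonotoneDecoder → Str → ℕ → Set
KmLe ψ x k = Σ Str λ p → (length p ≤ k) × (x ⊑out[ ψ ] p)

Optimal : MonotoneDecoder → Set
Optimal ψ = ∀ (ψ′ : MonotoneDecoder) → Σ ℕ λ c →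
            ∀ x k → KmLe ψ′ x k → KmLe ψ x (k + c)

½ : ℚ
½ = + 1 / 2

pow½ : ℕ → ℚ
pow½ zero    = 1ℚ
pow½ (suc l) = ½ *ℚ pow½ l

partialSum : (ℕ → Str) → ℕ → ℕ → ℚ
partialSum x m zero    = 0ℚ
partialSum x m (suc N) = pow½ (length (x m)) +ℚ partialSum x (suc m) N

ComputableStrSeq : (ℕ → Str) → Set
ComputableStrSeq x = Σ (PR 1) λ c → ∀ n → c [ n ∷ [] ]⇓ encode (x n)

-- total Solovay test: computable {x_n} with a computable rate of
-- convergence m(δ): Σ_{i ≥ m(δ)} 2^(-l(x_i)) ≤ δ for every positive
-- rational δ = (a+1)/(b+1) (tail sum ≤ δ ⟺ all its partial sums ≤ δ).
record TotalSolovayTest : Set where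
  field
    x          : ℕ → Str
    x-comp     : ComputableStrSeq x
    rate       : ℕ → ℕ → ℕ
    rate-comp  : Computable₂ rate
    rate-bound : ∀ a b N → partialSum x (rate a b) N ≤ℚ (+ suc a / suc b)

Passes : Seq → (ℕ → Str) → Set
Passes ω x = ¬ (∀ N → Σ ℕ λ n → (N ≤ n) × (x n ⊑ω ω))

Unbounded : (ℕ → ℕ) → Set
Unbounded σ = ∀ B → Σ ℕ λ n → B ≤ σ n

-- Fix k and let m(k) be an index beyond which the test has mass at most 2^-5k.
-- Kraft's inequality then holds for the lengths l(x_i) + 1 - 3k, i ≥ m(k), so the
-- Shannon–Fano–Elias construction gives these x_i prefix-free codewords of those
-- lengths, and one monotone decoder maps 1^k 0 (codeword of x_i) to x_i for all k.
-- Hence Km(x_i) ≤ l(x_i) + 2 - 2k + O(1) whenever i ≥ m(k).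
-- Let σ(n) count the k < n such that no x_i with i < m(k) has length n; σ is
-- computable and unbounded. If x_i ⊑ ω for infinitely many i, pick one with
-- σ(n) large, n = l(x_i), and let k be the largest counted index below n. Then
-- σ(n) ≤ k + 1 and i ≥ m(k), so Km(ω^n) ≤ n + 2 - 2k + O(1), which contradicts
-- Km(ω^n) ≥ n - σ(n) - c for large k.

module Submission where

open import Defs
open import Data.Bool using (Bool; true; false)
open import Data.Empty using (⊥-elim)
open import Data.Fin using (Fin; zero; suc)
open import Data.List using ([]; _∷_; length; _++_; take; drop; replicate)
open import Data.List.Properties using (length-take; take++drop≡id; take-all; length-++; length-replicate)
open import Data.Nat
open import Data.Nat.DivMod
open import Data.Nat.Divisibility using (divides)
open import Data.Nat.Properties
open import Data.Nat.Tactic.RingSolver using (solve-∀)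
open import Data.Product using (Σ; _×_; _,_; proj₁; proj₂)
open import Data.Sum using (_⊎_; inj₁; inj₂)
open import Data.Vec using (Vec; []; _∷_; lookup; tabulate)
open import Data.Vec.Properties using (tabulate∘lookup)
open import Function using (_∘′_)
open import Relation.Binary.Definitions using (tri<; tri≈; tri>)
open import Relation.Binary.PropositionalEquality
open import Relation.Nullary using (¬_; yes; no; contradiction)

import Data.Integer as ℤ
import Data.Integer.Properties as ℤ
import Data.Rational as ℚ
import Data.Rational.Properties as ℚ
import Data.Rational.Unnormalised as ℚᵘ
import Data.Rational.Unnormalised.Properties as ℚᵘ

mutual
  ⇓-deterministic : ∀ {n} {f : PR n} {xs a b} → f [ xs ]⇓ a → f [ xs ]⇓ b → a ≡ b
  ⇓-deterministic ev-zer ev-zer = refl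
  ⇓-deterministic ev-succ ev-succ = refl
  ⇓-deterministic ev-proj ev-proj = refl
  ⇓-deterministic (ev-comp p q) (ev-comp p′ q′) with ⇓*-deterministic p p′
  ... | refl = ⇓-deterministic q q′
  ⇓-deterministic (ev-prec0 p) (ev-prec0 q) = ⇓-deterministic p q
  ⇓-deterministic (ev-precS p q) (ev-precS p′ q′) with ⇓-deterministic p p′
  ... | refl = ⇓-deterministic q q′
  ⇓-deterministic (ev-mu {k = k} z h) (ev-mu {k = k′} z′ h′) with <-cmp k k′
  ... | tri< k<k′ _ _ = ⊥-elim (⇓-suc-zero (h′ k k<k′) z)
  ... | tri≈ _ k≡k′ _ = k≡k′
  ... | tri> _ _ k>k′ = ⊥-elim (⇓-suc-zero (h k′ k>k′) z′)

  ⇓-suc-zero : ∀ {n} {f : PR n} {xs} → Σ ℕ (λ v → f [ xs ]⇓ suc v) → ¬ (f [ xs ]⇓ 0)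
  ⇓-suc-zero (v , p) q with ⇓-deterministic p q
  ... | ()

  ⇓*-deterministic : ∀ {m n} {gs : Vec (PR n) m} {xs as bs} → gs [ xs ]⇓* as → gs [ xs ]⇓* bs → as ≡ bs
  ⇓*-deterministic ev-[] ev-[] = refl
  ⇓*-deterministic (ev-∷ p ps) (ev-∷ q qs) = cong₂ _∷_ (⇓-deterministic p q) (⇓*-deterministic ps qs)

Computes : ∀ {n} → PR n → (Vec ℕ n → ℕ) → Set
Computes c f = ∀ xs → c [ xs ]⇓ f xs

Sum : ℕ → (ℕ → ℕ) → ℕ
Sum zero    f = 0
Sum (suc n) f = Sum n f + f n

Rec : ℕ → (ℕ → ℕ → ℕ) → ℕ → ℕ
Rec b s zero    = b
Rec b s (suc k) = s k (Rec b s k)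

data Exp (n : ℕ) : Set where
  var  : Fin n → Exp n
  zro  : Exp n
  call : ∀ {m} (c : PR m) (f : Vec ℕ m → ℕ) → Computes c f → Vec (Exp n) m → Exp n
  rec  : Exp n → Exp (suc (suc n)) → Exp n → Exp n
  sum  : Exp n → Exp (suc n) → Exp n

mutual
  ⟦_⟧ : ∀ {n} → Exp n → Vec ℕ n → ℕ
  ⟦ var i ⟧         xs = lookup xs i
  ⟦ zro ⟧           xs = 0
  ⟦ call c f _ es ⟧ xs = f (⟦ es ⟧* xs)
  ⟦ rec b s a ⟧     xs = Rec (⟦ b ⟧ xs) (λ j r → ⟦ s ⟧ (j ∷ r ∷ xs)) (⟦ a ⟧ xs)
  ⟦ sum b e ⟧       xs = Sum (⟦ b ⟧ xs) (λ j → ⟦ e ⟧ (j ∷ xs))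

  ⟦_⟧* : ∀ {n m} → Vec (Exp n) m → Vec ℕ n → Vec ℕ m
  ⟦ [] ⟧*     xs = []
  ⟦ e ∷ es ⟧* xs = ⟦ e ⟧ xs ∷ ⟦ es ⟧* xs

projections : ∀ {n m} → (Fin n → Fin m) → Vec (PR m) n
projections ρ = tabulate (λ i → proj (ρ i))

projections-⇓* : ∀ {n m} (ρ : Fin n → Fin m) (ys : Vec ℕ m) →
                 projections ρ [ ys ]⇓* tabulate (λ i → lookup ys (ρ i))
projections-⇓* {zero}  ρ ys = ev-[]
projections-⇓* {suc n} ρ ys = ev-∷ ev-proj (projections-⇓* (λ i → ρ (suc i)) ys)

identity-⇓* : ∀ {n} (xs : Vec ℕ n) → projections (λ i → i) [ xs ]⇓* xs
identity-⇓* xs = subst (projections (λ i → i) [ xs ]⇓*_) (tabulate∘lookup xs) (projections-⇓* (λ i → i) xs)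

drop₂-⇓* : ∀ {n} j r (xs : Vec ℕ n) → projections (λ i → suc (suc i)) [ j ∷ r ∷ xs ]⇓* xs
drop₂-⇓* j r xs = subst (projections (λ i → suc (suc i)) [ j ∷ r ∷ xs ]⇓*_) (tabulate∘lookup xs)
                        (projections-⇓* (λ i → suc (suc i)) (j ∷ r ∷ xs))

prec-⇓ : ∀ {n} {g : PR n} {h : PR (suc (suc n))} {G : Vec ℕ n → ℕ} {H : ℕ → ℕ → Vec ℕ n → ℕ} →
         Computes g G → (∀ j r xs → h [ j ∷ r ∷ xs ]⇓ H j r xs) →
         ∀ k xs → prec g h [ k ∷ xs ]⇓ Rec (G xs) (λ j r → H j r xs) k
prec-⇓ g⇓ h⇓ zero    xs = ev-prec0 (g⇓ xs)
prec-⇓ g⇓ h⇓ (suc k) xs = ev-precS (prec-⇓ g⇓ h⇓ k xs) (h⇓ _ _ xs)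

addCode : PR 2
addCode = prec (proj zero) (comp succ (proj (suc zero) ∷ []))

addCode-⇓ : ∀ a b → addCode [ a ∷ b ∷ [] ]⇓ (a + b)
addCode-⇓ zero    b = ev-prec0 ev-proj
addCode-⇓ (suc a) b = ev-precS (addCode-⇓ a b) (ev-comp (ev-∷ ev-proj ev-[]) ev-succ)

Rec-accumulate≡Sum : ∀ (g : ℕ → ℕ) k → Rec 0 (λ j r → r + g j) k ≡ Sum k g
Rec-accumulate≡Sum g zero    = refl
Rec-accumulate≡Sum g (suc k) = cong (_+ g k) (Rec-accumulate≡Sum g k)

accumulate : ∀ {n} → PR (suc n) → PR (suc (suc n))
accumulate c = comp addCode (proj (suc zero) ∷ comp c (proj zero ∷ projections (λ i → suc (suc i))) ∷ [])

accumulate-⇓ : ∀ {n} {c : PR (suc n)} {F} → Computes c F → ∀ j r xs → accumulate c [ j ∷ r ∷ xs ]⇓ (r + F (j ∷ xs))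
accumulate-⇓ c⇓ j r xs = ev-comp (ev-∷ ev-proj (ev-∷ (ev-comp (ev-∷ ev-proj (drop₂-⇓* j r xs)) (c⇓ _)) ev-[])) (addCode-⇓ r _)

mutual
  compile : ∀ {n} → Exp n → PR n
  compile (var i)         = proj i
  compile zro             = zer
  compile (call c f _ es) = comp c (compile* es)
  compile (rec b s a)     = comp (prec (compile b) (compile s)) (compile a ∷ projections (λ i → i))
  compile (sum b e)       = comp (prec zer (accumulate (compile e))) (compile b ∷ projections (λ i → i))

  compile* : ∀ {n m} → Vec (Exp n) m → Vec (PR n) m
  compile* []       = []
  compile* (e ∷ es) = compile e ∷ compile* es

mutual
  compile-correct : ∀ {n} (e : Exp n) → Computes (compile e) ⟦ e ⟧
  compile-correct (var i)          xs = ev-proj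
  compile-correct zro              xs = ev-zer
  compile-correct (call c f c⇓ es) xs = ev-comp (compile*-correct es xs) (c⇓ _)
  compile-correct (rec b s a)      xs =
    ev-comp (ev-∷ (compile-correct a xs) (identity-⇓* xs))
            (prec-⇓ (compile-correct b) (λ j r ys → compile-correct s (j ∷ r ∷ ys)) (⟦ a ⟧ xs) xs)
  compile-correct (sum b e)        xs =
    ev-comp (ev-∷ (compile-correct b xs) (identity-⇓* xs))
            (subst (_ [ _ ]⇓_) (Rec-accumulate≡Sum (λ j → ⟦ e ⟧ (j ∷ xs)) (⟦ b ⟧ xs))
                   (prec-⇓ (λ _ → ev-zer) (accumulate-⇓ (compile-correct e)) (⟦ b ⟧ xs) xs))

  compile*-correct : ∀ {n m} (es : Vec (Exp n) m) xs → compile* es [ xs ]⇓* ⟦ es ⟧* xs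
  compile*-correct []       xs = ev-[]
  compile*-correct (e ∷ es) xs = ev-∷ (compile-correct e xs) (compile*-correct es xs)

-- Wrapping e as a primitive with semantics f keeps the semantics of larger expressions small.
define : ∀ {m n} (e : Exp m) (f : Vec ℕ m → ℕ) → (∀ xs → ⟦ e ⟧ xs ≡ f xs) → Vec (Exp n) m → Exp n
define e f e≡f = call (compile e) f (λ xs → subst (compile e [ xs ]⇓_) (e≡f xs) (compile-correct e xs))

apply₁ : ∀ {n} (g : ℕ → ℕ) (e : Exp 1) → (∀ a → ⟦ e ⟧ (a ∷ []) ≡ g a) → Exp n → Exp n
apply₁ g e e≡g x = define e (λ { (a ∷ []) → g a }) (λ { (a ∷ []) → e≡g a }) (x ∷ [])

apply₂ : ∀ {n} (g : ℕ → ℕ → ℕ) (e : Exp 2) → (∀ a b → ⟦ e ⟧ (a ∷ b ∷ []) ≡ g a b) → Exp n → Exp n → Exp n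
apply₂ g e e≡g x y = define e (λ { (a ∷ b ∷ []) → g a b }) (λ { (a ∷ b ∷ []) → e≡g a b }) (x ∷ y ∷ [])

external₁ : ∀ {n} (g : ℕ → ℕ) → Computable₁ g → Exp n → Exp n
external₁ g (c , c⇓) x = call c (λ { (a ∷ []) → g a }) (λ { (a ∷ []) → c⇓ a }) (x ∷ [])

external₂ : ∀ {n} (g : ℕ → ℕ → ℕ) → Computable₂ g → Exp n → Exp n → Exp n
external₂ g (c , c⇓) x y = call c (λ { (a ∷ b ∷ []) → g a b }) (λ { (a ∷ b ∷ []) → c⇓ a b }) (x ∷ y ∷ [])

v₀ : ∀ {n} → Exp (suc n)
v₀ = var zero

v₁ : ∀ {n} → Exp (suc (suc n))
v₁ = var (suc zero)

v₂ : ∀ {n} → Exp (suc (suc (suc n)))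
v₂ = var (suc (suc zero))

v₃ : ∀ {n} → Exp (suc (suc (suc (suc n))))
v₃ = var (suc (suc (suc zero)))

v₄ : ∀ {n} → Exp (suc (suc (suc (suc (suc n)))))
v₄ = var (suc (suc (suc (suc zero))))

Suc : ∀ {n} → Exp n → Exp n
Suc x = call succ (λ { (a ∷ []) → suc a }) (λ { (a ∷ []) → ev-succ }) (x ∷ [])

numeral : ℕ → Exp 0
numeral zero    = zro
numeral (suc k) = Suc (numeral k)

numeral-correct : ∀ k → ⟦ numeral k ⟧ [] ≡ k
numeral-correct zero    = refl
numeral-correct (suc k) = cong suc (numeral-correct k)

lit : ∀ {n} → ℕ → Exp n
lit k = define (numeral k) (λ _ → k) (λ { [] → numeral-correct k }) []

addExp : Exp 2
addExp = rec v₀ (Suc v₁) v₁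

addExp-correct : ∀ a b → ⟦ addExp ⟧ (a ∷ b ∷ []) ≡ a + b
addExp-correct a zero    = sym (+-identityʳ a)
addExp-correct a (suc b) = trans (cong suc (addExp-correct a b)) (sym (+-suc a b))

infixl 6 _⊕_ _⊖_
infixl 7 _⊗_

_⊕_ : ∀ {n} → Exp n → Exp n → Exp n
_⊕_ = apply₂ _+_ addExp addExp-correct

mulExp : Exp 2
mulExp = rec zro (v₁ ⊕ v₂) v₁

mulExp-correct : ∀ a b → ⟦ mulExp ⟧ (a ∷ b ∷ []) ≡ a * b
mulExp-correct a zero    = sym (*-zeroʳ a)
mulExp-correct a (suc b) = trans (cong (_+ a) (mulExp-correct a b)) (trans (+-comm (a * b) a) (sym (*-suc a b)))

_⊗_ : ∀ {n} → Exp n → Exp n → Exp n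
_⊗_ = apply₂ _*_ mulExp mulExp-correct

predExp : Exp 1
predExp = rec zro v₀ v₀

predExp-correct : ∀ a → ⟦ predExp ⟧ (a ∷ []) ≡ pred a
predExp-correct zero    = refl
predExp-correct (suc a) = refl

monusExp : Exp 2
monusExp = rec v₀ (apply₁ pred predExp predExp-correct v₁) v₁

monusExp-correct : ∀ a b → ⟦ monusExp ⟧ (a ∷ b ∷ []) ≡ a ∸ b
monusExp-correct a zero    = refl
monusExp-correct a (suc b) = trans (cong pred (monusExp-correct a b)) (pred[m∸n]≡m∸[1+n] a b)

_⊖_ : ∀ {n} → Exp n → Exp n → Exp n
_⊖_ = apply₂ _∸_ monusExp monusExp-correct

pow2Exp : Exp 1
pow2Exp = rec (lit 1) (v₁ ⊕ v₁) v₀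

pow2Exp-correct : ∀ a → ⟦ pow2Exp ⟧ (a ∷ []) ≡ 2 ^ a
pow2Exp-correct zero    = refl
pow2Exp-correct (suc a) = trans (cong (λ r → r + r) (pow2Exp-correct a)) (cong (2 ^ a +_) (sym (+-identityʳ (2 ^ a))))

Pow2 : ∀ {n} → Exp n → Exp n
Pow2 = apply₁ (2 ^_) pow2Exp pow2Exp-correct

-- Arithmetic by counting

isZero : ℕ → ℕ
isZero a = 1 ∸ a

leq : ℕ → ℕ → ℕ
leq a b = isZero (a ∸ b)

>0⇒isZero≡0 : ∀ {a} → 0 < a → isZero a ≡ 0
>0⇒isZero≡0 {suc a} _ = 0∸n≡0 a

isZero≡0⇒>0 : ∀ a → isZero a ≡ 0 → 0 < a
isZero≡0⇒>0 (suc a) _ = z<s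

isZero>0⇒≡0 : ∀ a → 0 < isZero a → a ≡ 0
isZero>0⇒≡0 zero    _ = refl
isZero>0⇒≡0 (suc a) p = contradiction (subst (0 <_) (0∸n≡0 a) p) (<-irrefl refl)

isZero≤1 : ∀ a → isZero a ≤ 1
isZero≤1 a = m∸n≤m 1 a

leq-≤ : ∀ {a b} → a ≤ b → leq a b ≡ 1
leq-≤ a≤b rewrite m≤n⇒m∸n≡0 a≤b = refl

leq-> : ∀ {a b} → b < a → leq a b ≡ 0
leq-> b<a = >0⇒isZero≡0 (m<n⇒0<n∸m b<a)

∣-∣≡∸+∸ : ∀ a b → ∣ a - b ∣ ≡ (a ∸ b) + (b ∸ a)
∣-∣≡∸+∸ zero    zero    = refl
∣-∣≡∸+∸ zero    (suc b) = refl
∣-∣≡∸+∸ (suc a) zero    = sym (+-identityʳ (suc a))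
∣-∣≡∸+∸ (suc a) (suc b) = ∣-∣≡∸+∸ a b

m<n⇒0<∣m-n∣ : ∀ {a b} → a < b → 0 < ∣ a - b ∣
m<n⇒0<∣m-n∣ {a} {b} a<b = subst (0 <_) (sym (∣-∣≡∸+∸ a b)) (≤-trans (m<n⇒0<n∸m a<b) (m≤n+m (b ∸ a) (a ∸ b)))

Sum-cong : ∀ n {f g : ℕ → ℕ} → (∀ j → j < n → f j ≡ g j) → Sum n f ≡ Sum n g
Sum-cong zero    f≡g = refl
Sum-cong (suc n) f≡g = cong₂ _+_ (Sum-cong n (λ j j<n → f≡g j (m<n⇒m<1+n j<n))) (f≡g n ≤-refl)

Sum-monoˡ-≤ : ∀ {n n′} (f : ℕ → ℕ) → n ≤ n′ → Sum n f ≤ Sum n′ f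
Sum-monoˡ-≤ {n} {n′} f n≤n′ with m≤n⇒m<n∨m≡n n≤n′
... | inj₂ refl = ≤-refl
Sum-monoˡ-≤ {n} {suc n′} f n≤n′ | inj₁ (s≤s n≤n″) = ≤-trans (Sum-monoˡ-≤ f n≤n″) (m≤m+n _ _)

term≤Sum : ∀ n (f : ℕ → ℕ) j → j < n → f j ≤ Sum n f
term≤Sum (suc n) f j j<1+n with m≤n⇒m<n∨m≡n (≤-pred j<1+n)
... | inj₁ j<n  = ≤-trans (term≤Sum n f j j<n) (m≤m+n _ _)
... | inj₂ refl = m≤n+m _ _

*-distribˡ-Sum : ∀ n c (f : ℕ → ℕ) → Sum n (λ j → c * f j) ≡ c * Sum n f
*-distribˡ-Sum zero    c f = sym (*-zeroʳ c)
*-distribˡ-Sum (suc n) c f = trans (cong (_+ c * f n) (*-distribˡ-Sum n c f)) (sym (*-distribˡ-+ c (Sum n f) (f n)))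

Sum-0 : ∀ n → Sum n (λ _ → 0) ≡ 0
Sum-0 zero    = refl
Sum-0 (suc n) = trans (+-identityʳ _) (Sum-0 n)

Sum-1 : ∀ n → Sum n (λ _ → 1) ≡ n
Sum-1 zero    = refl
Sum-1 (suc n) = trans (cong (_+ 1) (Sum-1 n)) (+-comm n 1)

Sum>0⇒term>0 : ∀ n (f : ℕ → ℕ) → 0 < Sum n f → Σ ℕ λ j → j < n × 0 < f j
Sum>0⇒term>0 (suc n) f Sum>0 with f n in eq
... | suc _ = n , ≤-refl , subst (0 <_) (sym eq) z<s
... | zero  with Sum>0⇒term>0 n f (subst (0 <_) (+-identityʳ (Sum n f)) Sum>0)
...   | j , j<n , fj>0 = j , m<n⇒m<1+n j<n , fj>0

Sum-≤1 : ∀ n (f : ℕ → ℕ) → (∀ j → f j ≤ 1) → Sum n f ≤ n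
Sum-≤1 zero    f f≤1 = z≤n
Sum-≤1 (suc n) f f≤1 = subst (Sum n f + f n ≤_) (+-comm n 1) (+-mono-≤ (Sum-≤1 n f f≤1) (f≤1 n))

Sum-≤1+last : ∀ n (f : ℕ → ℕ) → (∀ j → f j ≤ 1) → 0 < Sum n f → Σ ℕ λ k → k < n × 0 < f k × Sum n f ≤ suc k
Sum-≤1+last (suc n) f f≤1 Sum>0 with f n in eq
... | suc _ = n , ≤-refl , subst (0 <_) (sym eq) z<s , subst (_≤ suc n) (cong (Sum n f +_) eq) (Sum-≤1 (suc n) f f≤1)
... | zero  with Sum-≤1+last n f f≤1 (subst (0 <_) (+-identityʳ (Sum n f)) Sum>0)
...   | k , k<n , fk>0 , Sum≤ = k , m<n⇒m<1+n k<n , fk>0 , subst (_≤ suc k) (sym (+-identityʳ _)) Sum≤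

Sum-indicator : ∀ (f : ℕ → ℕ) c → (∀ t → t < c → f t ≡ 1) → (∀ t → c ≤ t → f t ≡ 0) → ∀ n → Sum n f ≡ n ⊓ c
Sum-indicator f c below above zero = refl
Sum-indicator f c below above (suc n) with n <? c
... | yes n<c rewrite Sum-indicator f c below above n | below n n<c | m≤n⇒m⊓n≡m (<⇒≤ n<c) | m≤n⇒m⊓n≡m n<c = +-comm n 1
... | no n≮c rewrite Sum-indicator f c below above n | above n (≮⇒≥ n≮c) | m≥n⇒m⊓n≡n (≮⇒≥ n≮c)
                   | m≥n⇒m⊓n≡n (≤-trans (≮⇒≥ n≮c) (n≤1+n n)) = +-identityʳ c

divCount : ℕ → ℕ → ℕ
divCount a d = Sum a (λ q → leq (suc q * d) a)

modCount : ℕ → ℕ → ℕ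
modCount a d = a ∸ divCount a d * d

divCount≡/ : ∀ a d .{{_ : NonZero d}} → divCount a d ≡ a / d
divCount≡/ a d = trans (Sum-indicator _ (a / d) below above a) (m≥n⇒m⊓n≡n (m/n≤m a d))
  where
  below : ∀ t → t < a / d → leq (suc t * d) a ≡ 1
  below t t<a/d = leq-≤ (≤-trans (*-monoˡ-≤ d t<a/d) (m/n*n≤m a d))
  above : ∀ t → a / d ≤ t → leq (suc t * d) a ≡ 0
  above t a/d≤t = leq-> (≰⇒> λ le → <⇒≱ (s≤s a/d≤t) (subst (_≤ a / d) (m*n/n≡m (suc t) d) (/-monoˡ-≤ d le)))

modCount≡% : ∀ a d .{{_ : NonZero d}} → modCount a d ≡ a % d
modCount≡% a d = trans (cong (λ q → a ∸ q * d) (divCount≡/ a d)) (sym (m%n≡m∸m/n*n a d))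

⌈/⌉-bounds : ∀ n d .{{_ : NonZero d}} → n ≤ (n + d ∸ 1) / d * d × (n + d ∸ 1) / d * d < n + d
⌈/⌉-bounds n d@(suc d′) = lower , upper
  where
  a = n + d ∸ 1
  a≡ : a ≡ n + d′
  a≡ = cong (_∸ 1) (+-suc n d′)
  upper : a / d * d < n + d
  upper = ≤-<-trans (m/n*n≤m a d) (subst (_< n + d) (sym a≡) (+-monoʳ-< n (n<1+n d′)))
  lower : n ≤ a / d * d
  lower = +-cancelˡ-≤ d′ n (a / d * d) (begin
    d′ + n             ≡⟨ trans (+-comm d′ n) (sym a≡) ⟩
    a                  ≡⟨ m≡m%n+[m/n]*n a d ⟩
    a % d + a / d * d  ≤⟨ +-monoˡ-≤ (a / d * d) (≤-pred (m%n<n a d)) ⟩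
    d′ + a / d * d     ∎)
    where open ≤-Reasoning

^-cancelʳ-≤ : ∀ {a b} → 2 ^ a ≤ 2 ^ b → a ≤ b
^-cancelʳ-≤ {a} {b} 2^a≤2^b with ≤-<-connex a b
... | inj₁ a≤b = a≤b
... | inj₂ b<a = contradiction (≤-<-trans 2^a≤2^b (^-monoʳ-< 2 (s≤s (s≤s z≤n)) b<a)) (<-irrefl refl)

bitValue : Bool → ℕ
bitValue false = 0
bitValue true  = 1

bitValue≤1 : ∀ b → bitValue b ≤ 1
bitValue≤1 false = z≤n
bitValue≤1 true  = s≤s z≤n

digits : Str → ℕ
digits []      = 0
digits (b ∷ s) = bitValue b + 2 * digits s

encode-∷ : ∀ b s → encode (b ∷ s) ≡ suc (bitValue b + 2 * encode s)
encode-∷ false s = refl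
encode-∷ true  s = refl

1+encode≡2^length+digits : ∀ s → suc (encode s) ≡ 2 ^ length s + digits s
1+encode≡2^length+digits []      = refl
1+encode≡2^length+digits (b ∷ s) = begin
  suc (encode (b ∷ s))                    ≡⟨ cong suc (encode-∷ b s) ⟩
  suc (suc (bitValue b + 2 * encode s))    ≡⟨ rearrange (bitValue b) (encode s) ⟩
  2 * suc (encode s) + bitValue b          ≡⟨ cong (λ e → 2 * e + bitValue b) (1+encode≡2^length+digits s) ⟩
  2 * (2 ^ length s + digits s) + bitValue b ≡⟨ rearrange′ (bitValue b) (2 ^ length s) (digits s) ⟩
  2 ^ length (b ∷ s) + digits (b ∷ s)     ∎
  where
  open ≡-Reasoning
  rearrange : ∀ v e → suc (suc (v + 2 * e)) ≡ 2 * suc e + v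
  rearrange = solve-∀
  rearrange′ : ∀ v p d → 2 * (p + d) + v ≡ 2 * p + (v + 2 * d)
  rearrange′ = solve-∀

digits<2^length : ∀ s → digits s < 2 ^ length s
digits<2^length []      = z<s
digits<2^length (b ∷ s) = begin-strict
  bitValue b + 2 * digits s   ≤⟨ +-monoˡ-≤ (2 * digits s) (bitValue≤1 b) ⟩
  1 + 2 * digits s            <⟨ n<1+n _ ⟩
  2 + 2 * digits s            ≡⟨ sym (*-suc 2 (digits s)) ⟩
  2 * suc (digits s)          ≤⟨ *-monoʳ-≤ 2 (digits<2^length s) ⟩
  2 * 2 ^ length s            ∎
  where open ≤-Reasoning

2^length≤1+encode : ∀ s → 2 ^ length s ≤ suc (encode s)
2^length≤1+encode s = subst (2 ^ length s ≤_) (sym (1+encode≡2^length+digits s)) (m≤m+n _ _)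

1+encode<2^1+length : ∀ s → suc (encode s) < 2 ^ suc (length s)
1+encode<2^1+length s = begin-strict
  suc (encode s)                    ≡⟨ 1+encode≡2^length+digits s ⟩
  2 ^ length s + digits s           <⟨ +-monoʳ-< (2 ^ length s) (digits<2^length s) ⟩
  2 ^ length s + 2 ^ length s       ≡⟨ cong (2 ^ length s +_) (sym (+-identityʳ _)) ⟩
  2 ^ suc (length s)                ∎
  where open ≤-Reasoning

encode-++ : ∀ a b → encode (a ++ b) ≡ encode a + 2 ^ length a * encode b
encode-++ []      b = sym (+-identityʳ _)
encode-++ (c ∷ a) b = begin
  encode (c ∷ (a ++ b))                                      ≡⟨ encode-∷ c (a ++ b) ⟩
  suc (bitValue c + 2 * encode (a ++ b))                      ≡⟨ cong (λ e → suc (bitValue c + 2 * e)) (encode-++ a b) ⟩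
  suc (bitValue c + 2 * (encode a + 2 ^ length a * encode b)) ≡⟨ cong suc (rearrange (bitValue c) (encode a) (2 ^ length a) (encode b)) ⟩
  suc (bitValue c + 2 * encode a) + 2 ^ length (c ∷ a) * encode b ≡⟨ cong (_+ 2 ^ length (c ∷ a) * encode b) (sym (encode-∷ c a)) ⟩
  encode (c ∷ a) + 2 ^ length (c ∷ a) * encode b              ∎
  where
  open ≡-Reasoning
  rearrange : ∀ v e p f → v + 2 * (e + p * f) ≡ v + 2 * e + 2 * p * f
  rearrange = solve-∀

encode-injective : ∀ a b → encode a ≡ encode b → a ≡ b
encode-injective []          []          eq = refl
encode-injective (false ∷ a) (false ∷ b) eq = cong (false ∷_) (encode-injective a b (*-cancelˡ-≡ _ _ 2 (suc-injective eq)))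
encode-injective (true ∷ a)  (true ∷ b)  eq = cong (true ∷_) (encode-injective a b (*-cancelˡ-≡ _ _ 2 (suc-injective (suc-injective eq))))
encode-injective (false ∷ a) (true ∷ b)  eq = ⊥-elim (even≢odd (encode a) (encode b) (suc-injective eq))
encode-injective (true ∷ a)  (false ∷ b) eq = ⊥-elim (even≢odd (encode b) (encode a) (sym (suc-injective eq)))
encode-injective []          (_ ∷ _)     eq = ⊥-elim (0≢1+n (trans eq (encode-∷ _ _)))
encode-injective (_ ∷ _)     []          eq = ⊥-elim (0≢1+n (trans (sym eq) (encode-∷ _ _)))

lengthOfCode : ℕ → ℕ
lengthOfCode e = Sum (suc e) (λ t → leq (2 ^ suc t) (suc e))

lengthOfCode-encode : ∀ s → lengthOfCode (encode s) ≡ length s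
lengthOfCode-encode s = trans (Sum-indicator _ (length s) below above (suc (encode s))) (m≥n⇒m⊓n≡n length≤1+encode)
  where
  below : ∀ t → t < length s → leq (2 ^ suc t) (suc (encode s)) ≡ 1
  below t t<l = leq-≤ (≤-trans (^-monoʳ-≤ 2 t<l) (2^length≤1+encode s))
  above : ∀ t → length s ≤ t → leq (2 ^ suc t) (suc (encode s)) ≡ 0
  above t l≤t = leq-> (≤-trans (1+encode<2^1+length s) (^-monoʳ-≤ 2 (s≤s l≤t)))
  length≤1+encode : length s ≤ suc (encode s)
  length≤1+encode = <⇒≤ (<-≤-trans (n<2^n (length s)) (2^length≤1+encode s))
    where
    n<2^n : ∀ n → n < 2 ^ n
    n<2^n zero    = z<s
    n<2^n (suc n) = subst (_< 2 ^ suc n) (+-comm n 1) (+-mono-<-≤ (n<2^n n) (subst (1 ≤_) (sym (+-identityʳ _)) (m^n>0 2 n)))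

encode≡2^length∸1+digits : ∀ s → encode s ≡ (2 ^ length s ∸ 1) + digits s
encode≡2^length∸1+digits s = begin
  encode s                       ≡⟨ cong (_∸ 1) (1+encode≡2^length+digits s) ⟩
  (2 ^ length s + digits s) ∸ 1  ≡⟨ +-∸-comm (digits s) (m^n>0 2 (length s)) ⟩
  (2 ^ length s ∸ 1) + digits s  ∎
  where open ≡-Reasoning

1+encode-++ : ∀ a b → suc (encode (a ++ b)) ≡ digits a + suc (encode b) * 2 ^ length a
1+encode-++ a b = begin
  suc (encode (a ++ b))                              ≡⟨ cong suc (encode-++ a b) ⟩
  suc (encode a) + 2 ^ length a * encode b           ≡⟨ cong (_+ 2 ^ length a * encode b) (1+encode≡2^length+digits a) ⟩
  2 ^ length a + digits a + 2 ^ length a * encode b  ≡⟨ rearrange (2 ^ length a) (digits a) (encode b) ⟩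
  digits a + suc (encode b) * 2 ^ length a           ∎
  where
  open ≡-Reasoning
  rearrange : ∀ p d e → p + d + p * e ≡ d + (1 + e) * p
  rearrange = solve-∀

pow2-nonZero : ∀ t → NonZero (2 ^ t)
pow2-nonZero t = m^n≢0 2 t

infixl 7 _/2^_ _%2^_

_/2^_ : ℕ → ℕ → ℕ
v /2^ t = _/_ v (2 ^ t) {{pow2-nonZero t}}

_%2^_ : ℕ → ℕ → ℕ
v %2^ t = _%_ v (2 ^ t) {{pow2-nonZero t}}

encode-take : ∀ w s → s ≤ length w → encode (take s w) ≡ (2 ^ s ∸ 1) + suc (encode w) %2^ s
encode-take w s s≤l = begin
  encode t                                         ≡⟨ encode≡2^length∸1+digits t ⟩
  (2 ^ length t ∸ 1) + digits t                    ≡⟨ cong (λ l → (2 ^ l ∸ 1) + digits t) length-t ⟩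
  (2 ^ s ∸ 1) + digits t                           ≡⟨ cong ((2 ^ s ∸ 1) +_) (sym digits-t≡) ⟩
  (2 ^ s ∸ 1) + suc (encode w) %2^ s               ∎
  where
  open ≡-Reasoning
  t = take s w
  r = drop s w
  length-t : length t ≡ s
  length-t = trans (length-take s w) (m≤n⇒m⊓n≡m s≤l)
  1+encode-w : suc (encode w) ≡ digits t + suc (encode r) * 2 ^ s
  1+encode-w = trans (cong (suc ∘′ encode) (sym (take++drop≡id s w)))
                     (trans (1+encode-++ t r) (cong (λ l → digits t + suc (encode r) * 2 ^ l) length-t))
  digits-t≡ : suc (encode w) %2^ s ≡ digits t
  digits-t≡ = trans (cong (_%2^ s) 1+encode-w)
                    (trans ([m+kn]%n≡m%n (digits t) (suc (encode r)) (2 ^ s) {{pow2-nonZero s}})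
                           (m<n⇒m%n≡m {{pow2-nonZero s}} (subst (λ l → digits t < 2 ^ l) length-t (digits<2^length t))))

tri-<-suc : ∀ s b → b ≤ s → tri s + b < tri (suc s)
tri-<-suc s b b≤s = begin-strict
  tri s + b      ≤⟨ +-monoʳ-≤ (tri s) b≤s ⟩
  tri s + s      <⟨ +-monoʳ-< (tri s) (n<1+n s) ⟩
  tri s + suc s  ≡⟨ +-comm (tri s) (suc s) ⟩
  tri (suc s)    ∎
  where open ≤-Reasoning

tri-mono-≤ : ∀ {s s′} → s ≤ s′ → tri s ≤ tri s′
tri-mono-≤ {zero}  _         = z≤n
tri-mono-≤ {suc s} (s≤s s≤s′) = +-mono-≤ (s≤s s≤s′) (tri-mono-≤ s≤s′)

pair-<-diagonal : ∀ a b a′ b′ → a + b < a′ + b′ → pair a b < pair a′ b′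
pair-<-diagonal a b a′ b′ lt = begin-strict
  tri (a + b) + b    <⟨ tri-<-suc (a + b) b (m≤n+m b a) ⟩
  tri (suc (a + b))  ≤⟨ tri-mono-≤ lt ⟩
  tri (a′ + b′)      ≤⟨ m≤m+n _ b′ ⟩
  pair a′ b′         ∎
  where open ≤-Reasoning

pair-injective : ∀ a b a′ b′ → pair a b ≡ pair a′ b′ → (a ≡ a′) × (b ≡ b′)
pair-injective a b a′ b′ eq with <-cmp (a + b) (a′ + b′)
... | tri< lt _ _ = ⊥-elim (<-irrefl eq (pair-<-diagonal a b a′ b′ lt))
... | tri> _ _ gt = ⊥-elim (<-irrefl (sym eq) (pair-<-diagonal a′ b′ a b gt))
... | tri≈ _ s≡s′ _ = a≡a′ , b≡b′
  where
  b≡b′ : b ≡ b′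
  b≡b′ = +-cancelˡ-≡ (tri (a + b)) b b′ (trans eq (cong (λ s → tri s + b′) (sym s≡s′)))
  a≡a′ : a ≡ a′
  a≡a′ = +-cancelʳ-≡ b a a′ (trans s≡s′ (cong (a′ +_) (sym b≡b′)))

bit : ℕ → ℕ → ℕ
bit v t = v /2^ t % 2

bit≤1 : ∀ v t → bit v t ≤ 1
bit≤1 v t = ≤-pred (m%n<n (v /2^ t) 2)

toBool : ℕ → Bool
toBool zero    = false
toBool (suc _) = true

bitValue-toBool : ∀ b → b ≤ 1 → bitValue (toBool b) ≡ b
bitValue-toBool zero          _ = refl
bitValue-toBool (suc zero)    _ = refl
bitValue-toBool (suc (suc b)) (s≤s ())

bits : ℕ → ℕ → Str
bits zero    v = []
bits (suc l) v = toBool (bit v l) ∷ bits l v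

length-bits : ∀ l v → length (bits l v) ≡ l
length-bits zero    v = refl
length-bits (suc l) v = cong suc (length-bits l v)

/2^-/2^ : ∀ v a b → v /2^ a /2^ b ≡ v /2^ (b + a)
/2^-/2^ v a b = begin
  v /2^ a /2^ b                         ≡⟨ m/n/o≡m/[n*o] v (2 ^ a) (2 ^ b) {{pow2-nonZero a}} {{pow2-nonZero b}} {{nonZero-ab}} ⟩
  _/_ v (2 ^ a * 2 ^ b) {{nonZero-ab}}  ≡⟨ /-congʳ {{nonZero-ab}} {{pow2-nonZero (b + a)}} 2^a*2^b≡2^[b+a] ⟩
  v /2^ (b + a)                         ∎
  where
  open ≡-Reasoning
  nonZero-ab : NonZero (2 ^ a * 2 ^ b)
  nonZero-ab = m*n≢0 (2 ^ a) (2 ^ b) {{pow2-nonZero a}} {{pow2-nonZero b}}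
  2^a*2^b≡2^[b+a] : 2 ^ a * 2 ^ b ≡ 2 ^ (b + a)
  2^a*2^b≡2^[b+a] = trans (*-comm (2 ^ a) (2 ^ b)) (sym (^-distribˡ-+-* 2 b a))

bits-+ : ∀ l d v → bits (l + d) v ≡ bits l (v /2^ d) ++ bits d v
bits-+ zero    d v = refl
bits-+ (suc l) d v = cong₂ _∷_ (cong (λ u → toBool (u % 2)) (sym (/2^-/2^ v d l))) (bits-+ l d v)

fromBits : Str → ℕ
fromBits []      = 0
fromBits (b ∷ s) = bitValue b * 2 ^ length s + fromBits s

%2^-suc : ∀ v l → v %2^ suc l ≡ bit v l * 2 ^ l + v %2^ l
%2^-suc v l = begin
  u                               ≡⟨ m≡m%n+[m/n]*n u (2 ^ l) {{pow2-nonZero l}} ⟩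
  u %2^ l + u /2^ l * 2 ^ l       ≡⟨ cong₂ (λ a b → a + b * 2 ^ l) low high ⟩
  v %2^ l + bit v l * 2 ^ l       ≡⟨ +-comm (v %2^ l) _ ⟩
  bit v l * 2 ^ l + v %2^ l       ∎
  where
  open ≡-Reasoning
  u = v %2^ suc l
  low : u %2^ l ≡ v %2^ l
  low = m∣n⇒o%n%m≡o%m (2 ^ l) (2 ^ suc l) v {{pow2-nonZero l}} {{pow2-nonZero (suc l)}} (divides 2 refl)
  high : u /2^ l ≡ bit v l
  high = m%[n*o]/o≡m/o%n v 2 (2 ^ l) {{_}} {{pow2-nonZero l}} {{pow2-nonZero (suc l)}}

fromBits-bits : ∀ l v → fromBits (bits l v) ≡ v %2^ l
fromBits-bits zero    v = sym (n%1≡0 v)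
fromBits-bits (suc l) v = begin
  bitValue (toBool (bit v l)) * 2 ^ length (bits l v) + fromBits (bits l v)
    ≡⟨ cong₂ (λ a b → a * 2 ^ b + fromBits (bits l v)) (bitValue-toBool _ (bit≤1 v l)) (length-bits l v) ⟩
  bit v l * 2 ^ l + fromBits (bits l v)  ≡⟨ cong (bit v l * 2 ^ l +_) (fromBits-bits l v) ⟩
  bit v l * 2 ^ l + v %2^ l              ≡⟨ sym (%2^-suc v l) ⟩
  v %2^ suc l                            ∎
  where open ≡-Reasoning

bits-injective : ∀ l {v v′} → v < 2 ^ l → v′ < 2 ^ l → bits l v ≡ bits l v′ → v ≡ v′
bits-injective l {v} {v′} v< v′< eq = begin
  v                  ≡⟨ sym (m<n⇒m%n≡m {{pow2-nonZero l}} v<) ⟩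
  v %2^ l            ≡⟨ sym (fromBits-bits l v) ⟩
  fromBits (bits l v)  ≡⟨ cong fromBits eq ⟩
  fromBits (bits l v′) ≡⟨ fromBits-bits l v′ ⟩
  v′ %2^ l           ≡⟨ m<n⇒m%n≡m {{pow2-nonZero l}} v′< ⟩
  v′                 ∎
  where open ≡-Reasoning

⊑-refl : ∀ (s : Str) → s ⊑ s
⊑-refl []      = []⊑
⊑-refl (b ∷ s) = ∷⊑ (⊑-refl s)

⊑-trans : ∀ {a b c : Str} → a ⊑ b → b ⊑ c → a ⊑ c
⊑-trans []⊑    _      = []⊑
⊑-trans (∷⊑ p) (∷⊑ q) = ∷⊑ (⊑-trans p q)

⊑⇒length≤ : ∀ {p q} → p ⊑ q → length p ≤ length q
⊑⇒length≤ []⊑    = z≤n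
⊑⇒length≤ (∷⊑ p) = s≤s (⊑⇒length≤ p)

⊑-++-length≡ : ∀ p q r → p ⊑ (q ++ r) → length p ≡ length q → p ≡ q
⊑-++-length≡ []      []      r _      _  = refl
⊑-++-length≡ (b ∷ p) (c ∷ q) r (∷⊑ h) eq = cong (b ∷_) (⊑-++-length≡ p q r h (suc-injective eq))

bits-⊑ : ∀ l d {v v′} → v < 2 ^ l → v′ < 2 ^ (l + d) → bits l v ⊑ bits (l + d) v′ → v ≡ v′ /2^ d
bits-⊑ l d {v} {v′} v< v′< pre =
  bits-injective l v< v′/2^d< (⊑-++-length≡ _ _ _ pre′ (trans (length-bits l v) (sym (length-bits l _))))
  where
  pre′ : bits l v ⊑ (bits l (v′ /2^ d) ++ bits d v′)
  pre′ = subst (bits l v ⊑_) (bits-+ l d v′) pre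
  v′/2^d< : v′ /2^ d < 2 ^ l
  v′/2^d< = m<n*o⇒m/o<n {{pow2-nonZero d}} (subst (v′ <_) (^-distribˡ-+-* 2 l d) v′<)

m<[1+m/2^d]*2^d : ∀ m d → m < suc (m /2^ d) * 2 ^ d
m<[1+m/2^d]*2^d m d = subst (_< suc (m /2^ d) * 2 ^ d) (sym (m≡m%n+[m/n]*n m (2 ^ d) {{pow2-nonZero d}}))
                            (+-monoˡ-< (m /2^ d * 2 ^ d) (m%n<n m (2 ^ d) {{pow2-nonZero d}}))

unary-header-⊑ : ∀ k k′ {u u′} → (replicate k true ++ false ∷ u) ⊑ (replicate k′ true ++ false ∷ u′) →
                 k ≡ k′ × u ⊑ u′
unary-header-⊑ zero    zero     (∷⊑ u⊑u′) = refl , u⊑u′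
unary-header-⊑ (suc k) (suc k′) (∷⊑ pre)  = let k≡k′ , u⊑u′ = unary-header-⊑ k k′ pre in cong suc k≡k′ , u⊑u′

take-mono-⊑ : ∀ {s s′} (w : Str) → s ≤ s′ → take s w ⊑ take s′ w
take-mono-⊑ {zero}               w       _         = []⊑
take-mono-⊑ {suc s} {suc s′}     []      _         = []⊑
take-mono-⊑ {suc s} {suc s′}     (b ∷ w) (s≤s s≤s′) = ∷⊑ (take-mono-⊑ w s≤s′)

take-comparable : ∀ s s′ (w : Str) → Comparable (take s w) (take s′ w)
take-comparable s s′ w with ≤-total s s′
... | inj₁ s≤s′ = inj₁ (take-mono-⊑ w s≤s′)
... | inj₂ s′≤s = inj₂ (take-mono-⊑ w s′≤s)

take-⊑ : ∀ s (w : Str) → take s w ⊑ w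
take-⊑ zero    w       = []⊑
take-⊑ (suc s) []      = []⊑
take-⊑ (suc s) (b ∷ w) = ∷⊑ (take-⊑ s w)

⊑⇒≡take : ∀ {y w : Str} → y ⊑ w → y ≡ take (length y) w
⊑⇒≡take []⊑    = refl
⊑⇒≡take (∷⊑ p) = cong (_ ∷_) (⊑⇒≡take p)

prefix-length : ∀ {w : Str} {ω : Seq} → w ⊑ω ω → prefix ω (length w) ≡ w
prefix-length []⊑ω    = refl
prefix-length (∷⊑ω p) = cong (_ ∷_) (prefix-length p)

Leq : ∀ {n} → Exp n → Exp n → Exp n
Leq a b = lit 1 ⊖ (a ⊖ b)

IsZero : ∀ {n} → Exp n → Exp n
IsZero a = lit 1 ⊖ a

Dist : ∀ {n} → Exp n → Exp n → Exp n
Dist = apply₂ ∣_-_∣ ((v₀ ⊖ v₁) ⊕ (v₁ ⊖ v₀)) (λ a b → sym (∣-∣≡∸+∸ a b))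

DivCount : ∀ {n} → Exp n → Exp n → Exp n
DivCount = apply₂ divCount (sum v₀ (Leq (Suc v₀ ⊗ v₂) v₁)) (λ a d → refl)

Div2^ : ∀ {n} → Exp n → Exp n → Exp n
Div2^ = apply₂ _/2^_ (DivCount v₀ (Pow2 v₁)) (λ a t → divCount≡/ a (2 ^ t) {{pow2-nonZero t}})

Mod2^ : ∀ {n} → Exp n → Exp n → Exp n
Mod2^ = apply₂ _%2^_ (v₀ ⊖ DivCount v₀ (Pow2 v₁) ⊗ Pow2 v₁) (λ a t → modCount≡% a (2 ^ t) {{pow2-nonZero t}})

Bit : ∀ {n} → Exp n → Exp n → Exp n
Bit = apply₂ bit (Mod2^ (Div2^ v₀ v₁) (lit 1)) (λ v t → refl)

LengthOfCode : ∀ {n} → Exp n → Exp n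
LengthOfCode = apply₁ lengthOfCode (sum (Suc v₀) (Leq (Pow2 (Suc v₀)) (Suc v₁))) (λ e → refl)

Sum-suc≡tri : ∀ n → Sum n suc ≡ tri n
Sum-suc≡tri zero    = refl
Sum-suc≡tri (suc n) = trans (cong (_+ suc n) (Sum-suc≡tri n)) (+-comm (tri n) (suc n))

Pair : ∀ {n} → Exp n → Exp n → Exp n
Pair = apply₂ pair (apply₁ tri (sum v₀ (Suc v₀)) Sum-suc≡tri (v₀ ⊕ v₁) ⊕ v₁) (λ a b → refl)

encode-bits : ∀ l v → Rec 0 (λ t r → suc (bit v t + 2 * r)) l ≡ encode (bits l v)
encode-bits zero    v = refl
encode-bits (suc l) v = begin
  suc (bit v l + 2 * Rec 0 (λ t r → suc (bit v t + 2 * r)) l)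
    ≡⟨ cong₂ (λ b e → suc (b + 2 * e)) (sym (bitValue-toBool _ (bit≤1 v l))) (encode-bits l v) ⟩
  suc (bitValue (toBool (bit v l)) + 2 * encode (bits l v))    ≡⟨ sym (encode-∷ _ _) ⟩
  encode (bits (suc l) v)                                      ∎
  where open ≡-Reasoning

EncodeBits : ∀ {n} → Exp n → Exp n → Exp n
EncodeBits = apply₂ (λ l v → encode (bits l v)) (rec zro (Suc (Bit v₃ v₀ ⊕ lit 2 ⊗ v₁)) v₀) encode-bits

encode-replicate-true-++ : ∀ k w → Rec (encode w) (λ _ r → suc (suc (2 * r))) k ≡ encode (replicate k true ++ w)
encode-replicate-true-++ zero    w = refl
encode-replicate-true-++ (suc k) w = cong (λ r → suc (suc (2 * r))) (encode-replicate-true-++ k w)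

PositiveBelow : (ℕ → ℕ) → ℕ → Set
PositiveBelow f k = ∀ j → j < k → Σ ℕ λ v → f j ≡ suc v

first-zero-below : ∀ (f : ℕ → ℕ) n → (Σ ℕ λ k → f k ≡ 0 × PositiveBelow f k) ⊎ PositiveBelow f n
first-zero-below f zero = inj₂ (λ j ())
first-zero-below f (suc n) with first-zero-below f n
... | inj₁ found = inj₁ found
... | inj₂ positive with f n in eq
...   | zero  = inj₁ (n , eq , positive)
...   | suc v = inj₂ extended
  where
  extended : PositiveBelow f (suc n)
  extended j j<1+n with m≤n⇒m<n∨m≡n (≤-pred j<1+n)
  ... | inj₁ j<n  = positive j j<n
  ... | inj₂ refl = v , eq

first-zero : ∀ (f : ℕ → ℕ) t → f t ≡ 0 → Σ ℕ λ k → f k ≡ 0 × PositiveBelow f k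
first-zero f t ft≡0 with first-zero-below f (suc t)
... | inj₁ found    = found
... | inj₂ positive = ⊥-elim (0≢1+n (trans (sym ft≡0) (proj₂ (positive t ≤-refl))))

mu-halts : ∀ {n} (e : Exp (suc n)) xs t → ⟦ e ⟧ (t ∷ xs) ≡ 0 → Σ ℕ λ v → mu (compile e) [ xs ]⇓ v
mu-halts e xs t e≡0 with first-zero (λ t → ⟦ e ⟧ (t ∷ xs)) t e≡0
... | k , ek≡0 , positive = k , ev-mu (e⇓ k ek≡0) (λ j j<k → proj₁ (positive j j<k) , e⇓ j (proj₂ (positive j j<k)))
  where
  e⇓ : ∀ j {v} → ⟦ e ⟧ (j ∷ xs) ≡ v → compile e [ j ∷ xs ]⇓ v
  e⇓ j eq = subst (compile e [ j ∷ xs ]⇓_) eq (compile-correct e (j ∷ xs))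

mu-zero : ∀ {n} (e : Exp (suc n)) {xs v} → mu (compile e) [ xs ]⇓ v → ⟦ e ⟧ (v ∷ xs) ≡ 0
mu-zero e {xs} {v} (ev-mu e⇓0 _) = ⇓-deterministic (compile-correct e (v ∷ xs)) e⇓0

-- Partial sums of a test in integer units

sumFrom : (ℕ → ℕ) → ℕ → ℕ → ℕ
sumFrom g r zero    = 0
sumFrom g r (suc N) = g r + sumFrom g (suc r) N

sumFrom-snoc : ∀ g r N → sumFrom g r (suc N) ≡ sumFrom g r N + g (r + N)
sumFrom-snoc g r zero    = trans (+-identityʳ (g r)) (cong g (sym (+-identityʳ r)))
sumFrom-snoc g r (suc N) = begin
  g r + sumFrom g (suc r) (suc N)                ≡⟨ cong (g r +_) (sumFrom-snoc g (suc r) N) ⟩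
  g r + (sumFrom g (suc r) N + g (suc r + N))    ≡⟨ sym (+-assoc (g r) _ _) ⟩
  sumFrom g r (suc N) + g (suc r + N)            ≡⟨ cong (λ j → sumFrom g r (suc N) + g j) (sym (+-suc r N)) ⟩
  sumFrom g r (suc N) + g (r + suc N)            ∎
  where open ≡-Reasoning

Sum-leq≡sumFrom : ∀ (g : ℕ → ℕ) r N → Sum (r + N) (λ j → leq r j * g j) ≡ sumFrom g r N
Sum-leq≡sumFrom g r zero    = begin
  Sum (r + 0) (λ j → leq r j * g j)  ≡⟨ cong (λ n → Sum n (λ j → leq r j * g j)) (+-identityʳ r) ⟩
  Sum r (λ j → leq r j * g j)        ≡⟨ Sum-cong r (λ j j<r → cong (_* g j) (leq-> j<r)) ⟩
  Sum r (λ _ → 0)                    ≡⟨ Sum-0 r ⟩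
  0                                  ∎
  where open ≡-Reasoning
Sum-leq≡sumFrom g r (suc N) = begin
  Sum (r + suc N) F                       ≡⟨ cong (λ n → Sum n F) (+-suc r N) ⟩
  Sum (r + N) F + leq r (r + N) * g (r + N)
    ≡⟨ cong₂ _+_ (Sum-leq≡sumFrom g r N) (trans (cong (_* g (r + N)) (leq-≤ (m≤m+n r N))) (*-identityˡ _)) ⟩
  sumFrom g r N + g (r + N)               ≡⟨ sym (sumFrom-snoc g r N) ⟩
  sumFrom g r (suc N)                     ∎
  where
  open ≡-Reasoning
  F : ℕ → ℕ
  F j = leq r j * g j

-- mkℚᵘ (+ a) b denotes a / (b + 1).
mkℚᵘ-≃ : ∀ a b c d → a * suc d ≡ c * suc b → ℚᵘ.mkℚᵘ (ℤ.+ a) b ℚᵘ.≃ ℚᵘ.mkℚᵘ (ℤ.+ c) d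
mkℚᵘ-≃ a b c d eq = ℚᵘ.*≡* (trans (sym (ℤ.pos-* a (suc d))) (trans (cong ℤ.+_ eq) (ℤ.pos-* c (suc b))))

suc[2^n∸1]≡2^n : ∀ n → suc (2 ^ n ∸ 1) ≡ 2 ^ n
suc[2^n∸1]≡2^n n = trans (+-comm 1 (2 ^ n ∸ 1)) (m∸n+n≡m (m^n>0 2 n))

pow½≃1/2^ : ∀ l → ℚ.toℚᵘ (pow½ l) ℚᵘ.≃ ℚᵘ.mkℚᵘ (ℤ.+ 1) (2 ^ l ∸ 1)
pow½≃1/2^ zero    = ℚᵘ.*≡* refl
pow½≃1/2^ (suc l) =
  ℚᵘ.≃-trans (ℚ.toℚᵘ-homo-* ½ (pow½ l))
    (ℚᵘ.≃-trans (ℚᵘ.*-cong {ℚ.toℚᵘ ½} {ℚᵘ.mkℚᵘ (ℤ.+ 1) 1} (ℚᵘ.*≡* refl) (pow½≃1/2^ l))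
      (mkℚᵘ-≃ 1 _ 1 _ (cong (1 *_) (trans (suc[2^n∸1]≡2^n (suc l)) (cong (λ p → p + (p + 0)) (sym (suc[2^n∸1]≡2^n l)))))))

1/2^l≃2^[Λ∸l]/2^Λ : ∀ l Λ → l ≤ Λ →
                    ℚᵘ.mkℚᵘ (ℤ.+ 1) (2 ^ l ∸ 1) ℚᵘ.≃ ℚᵘ.mkℚᵘ (ℤ.+ (2 ^ (Λ ∸ l))) (2 ^ Λ ∸ 1)
1/2^l≃2^[Λ∸l]/2^Λ l Λ l≤Λ = mkℚᵘ-≃ 1 _ _ _ (begin
  1 * suc (2 ^ Λ ∸ 1)              ≡⟨ trans (*-identityˡ _) (suc[2^n∸1]≡2^n Λ) ⟩
  2 ^ Λ                            ≡⟨ cong (2 ^_) (sym (m∸n+n≡m l≤Λ)) ⟩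
  2 ^ (Λ ∸ l + l)                  ≡⟨ ^-distribˡ-+-* 2 (Λ ∸ l) l ⟩
  2 ^ (Λ ∸ l) * 2 ^ l              ≡⟨ cong (2 ^ (Λ ∸ l) *_) (sym (suc[2^n∸1]≡2^n l)) ⟩
  2 ^ (Λ ∸ l) * suc (2 ^ l ∸ 1)    ∎)
  where open ≡-Reasoning

mkℚᵘ-+-same-denominator : ∀ a b d →
                          (ℚᵘ.mkℚᵘ (ℤ.+ a) d ℚᵘ.+ ℚᵘ.mkℚᵘ (ℤ.+ b) d) ℚᵘ.≃ ℚᵘ.mkℚᵘ (ℤ.+ (a + b)) d
mkℚᵘ-+-same-denominator a b d = ℚᵘ.*≡* (begin
  (ℤ.+ a ℤ.* ℤ.+ e ℤ.+ ℤ.+ b ℤ.* ℤ.+ e) ℤ.* ℤ.+ e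
    ≡⟨ cong (ℤ._* ℤ.+ e) (cong₂ ℤ._+_ (sym (ℤ.pos-* a e)) (sym (ℤ.pos-* b e))) ⟩
  (ℤ.+ (a * e) ℤ.+ ℤ.+ (b * e)) ℤ.* ℤ.+ e         ≡⟨ cong (ℤ._* ℤ.+ e) (sym (ℤ.pos-+ (a * e) (b * e))) ⟩
  ℤ.+ (a * e + b * e) ℤ.* ℤ.+ e                   ≡⟨ sym (ℤ.pos-* (a * e + b * e) e) ⟩
  ℤ.+ ((a * e + b * e) * e)                       ≡⟨ cong ℤ.+_ (rearrange a b e) ⟩
  ℤ.+ ((a + b) * (e * e))                         ≡⟨ ℤ.pos-* (a + b) (e * e) ⟩
  ℤ.+ (a + b) ℤ.* ℤ.+ (e * e)                     ∎)
  where
  open ≡-Reasoning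
  e = suc d
  rearrange : ∀ a b e → (a * e + b * e) * e ≡ (a + b) * (e * e)
  rearrange = solve-∀

module _ (x : ℕ → Str) (Λ : ℕ) where

  scaledMass : ℕ → ℕ
  scaledMass j = 2 ^ (Λ ∸ length (x j))

  partialSum≃sumFrom : ∀ N r → (∀ t → t < N → length (x (r + t)) ≤ Λ) →
                       ℚ.toℚᵘ (partialSum x r N) ℚᵘ.≃ ℚᵘ.mkℚᵘ (ℤ.+ sumFrom scaledMass r N) (2 ^ Λ ∸ 1)
  partialSum≃sumFrom zero    r short = ℚᵘ.*≡* refl
  partialSum≃sumFrom (suc N) r short =
    ℚᵘ.≃-trans (ℚ.toℚᵘ-homo-+ (pow½ (length (x r))) (partialSum x (suc r) N))
      (ℚᵘ.≃-trans (ℚᵘ.+-cong (ℚᵘ.≃-trans (pow½≃1/2^ (length (x r))) (1/2^l≃2^[Λ∸l]/2^Λ _ Λ first-short))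
                             (partialSum≃sumFrom N (suc r) rest-short))
                  (mkℚᵘ-+-same-denominator (scaledMass r) (sumFrom scaledMass (suc r) N) (2 ^ Λ ∸ 1)))
    where
    first-short : length (x r) ≤ Λ
    first-short = subst (λ j → length (x j) ≤ Λ) (+-identityʳ r) (short 0 z<s)
    rest-short : ∀ t → t < N → length (x (suc r + t)) ≤ Λ
    rest-short t t<N = subst (λ j → length (x j) ≤ Λ) (+-suc r t) (short (suc t) (s≤s t<N))

  partialSum≤⇒sumFrom≤ : ∀ N r b → (∀ t → t < N → length (x (r + t)) ≤ Λ) →
                         partialSum x r N ℚ.≤ (ℤ.+ 1 ℚ./ suc b) → sumFrom scaledMass r N * suc b ≤ 2 ^ Λ
  partialSum≤⇒sumFrom≤ N r b short sum≤ with
    ℚᵘ.≤-respʳ-≃ (ℚ.toℚᵘ-fromℚᵘ (ℚᵘ.mkℚᵘ (ℤ.+ 1) b))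
                 (ℚᵘ.≤-respˡ-≃ (partialSum≃sumFrom N r short) (ℚ.toℚᵘ-mono-≤ sum≤))
  ... | ℚᵘ.*≤* cross = subst (sumFrom scaledMass r N * suc b ≤_) (trans (*-identityˡ _) (suc[2^n∸1]≡2^n Λ))
                             (ℤ.drop‿+≤+ (subst₂ ℤ._≤_ (sym (ℤ.pos-* (sumFrom scaledMass r N) (suc b)))
                                                       (sym (ℤ.pos-* 1 (suc (2 ^ Λ ∸ 1)))) cross))

-- The Shannon–Fano–Elias code of a total Solovay test

module Construction (T : TotalSolovayTest) where
  open TotalSolovayTest T

  L : ℕ → ℕ
  L i = length (x i)

  -- Beyond tailIndex e the tail of the test has mass at most 2^-e.
  tailIndex : ℕ → ℕ
  tailIndex e = rate 0 (2 ^ e ∸ 1)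

  m : ℕ → ℕ
  m k = tailIndex (5 * k)

  -- 2^-Λ i is a common unit for the masses 2^-(L j) and 2^-(L j + 1) of all x_j, j ≤ i.
  Λ : ℕ → ℕ
  Λ i = Sum (suc i) (λ j → suc (L j))

  -- The mass of x_j in units 2^-Λ′, counted only for j ≥ r.
  weight : ℕ → ℕ → ℕ → ℕ
  weight r Λ′ j = leq r j * 2 ^ (Λ′ ∸ L j)

  N : ℕ → ℕ → ℕ
  N k i = Sum i (weight (m k) (Λ i))

  gap : ℕ → ℕ
  gap i = Λ i ∸ suc (L i)

  D : ℕ → ℕ
  D i = 2 ^ gap i

  -- Shannon–Fano–Elias: V k i / 2^(L i + 1) is the mass of the x_j with m k ≤ j < i
  -- rounded up, written with ℓ k i binary digits (its 3k leading zeros dropped).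
  V : ℕ → ℕ → ℕ
  V k i = (N k i + D i ∸ 1) /2^ gap i

  ℓ : ℕ → ℕ → ℕ
  ℓ k i = suc (L i) ∸ 3 * k

  codeword : ℕ → ℕ → Str
  codeword k i = bits (ℓ k i) (V k i)

  program : ℕ → ℕ → Str
  program k i = replicate k true ++ false ∷ codeword k i

  1+L≤Λ : ∀ {j i} → j ≤ i → suc (L j) ≤ Λ i
  1+L≤Λ {j} {i} j≤i = term≤Sum (suc i) (λ j → suc (L j)) j (s≤s j≤i)

  Λ-mono-≤ : ∀ {i i′} → i ≤ i′ → Λ i ≤ Λ i′
  Λ-mono-≤ i≤i′ = Sum-monoˡ-≤ _ (s≤s i≤i′)

  Λ≡gap+1+L : ∀ i → Λ i ≡ gap i + suc (L i)
  Λ≡gap+1+L i = sym (m∸n+n≡m (1+L≤Λ ≤-refl))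

  Λ∸L≡1+gap : ∀ i → Λ i ∸ L i ≡ suc (gap i)
  Λ∸L≡1+gap i = trans (cong (_∸ L i) (trans (Λ≡gap+1+L i) (+-suc (gap i) (L i)))) (m+n∸n≡m (suc (gap i)) (L i))

  1+L≡ℓ+3k : ∀ k i → 3 * k ≤ L i → suc (L i) ≡ ℓ k i + 3 * k
  1+L≡ℓ+3k k i 3k≤L = sym (m∸n+n≡m (m≤n⇒m≤1+n 3k≤L))

  N≤V*D : ∀ k i → N k i ≤ V k i * D i
  N≤V*D k i = proj₁ (⌈/⌉-bounds (N k i) (D i) {{pow2-nonZero (gap i)}})

  V*D<N+D : ∀ k i → V k i * D i < N k i + D i
  V*D<N+D k i = proj₂ (⌈/⌉-bounds (N k i) (D i) {{pow2-nonZero (gap i)}})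

  weight-self : ∀ {r i} → r ≤ i → weight r (Λ i) i ≡ 2 * D i
  weight-self {r} {i} r≤i = trans (cong (_* 2 ^ (Λ i ∸ L i)) (leq-≤ r≤i)) (trans (*-identityˡ _) (cong (2 ^_) (Λ∸L≡1+gap i)))

  N+2D≡Sum : ∀ k {i} → m k ≤ i → N k i + 2 * D i ≡ Sum (suc i) (weight (m k) (Λ i))
  N+2D≡Sum k {i} m≤i = cong (N k i +_) (sym (weight-self m≤i))

  weight-rescale : ∀ r Λ′ δ j → L j ≤ Λ′ → weight r Λ′ j * 2 ^ δ ≡ weight r (Λ′ + δ) j
  weight-rescale r Λ′ δ j L≤Λ′ = begin
    leq r j * 2 ^ (Λ′ ∸ L j) * 2 ^ δ    ≡⟨ *-assoc (leq r j) _ _ ⟩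
    leq r j * (2 ^ (Λ′ ∸ L j) * 2 ^ δ)  ≡⟨ cong (leq r j *_) (sym (^-distribˡ-+-* 2 (Λ′ ∸ L j) δ)) ⟩
    leq r j * 2 ^ (Λ′ ∸ L j + δ)        ≡⟨ cong (λ e → leq r j * 2 ^ e) (sym (+-∸-comm δ L≤Λ′)) ⟩
    leq r j * 2 ^ (Λ′ + δ ∸ L j)        ∎
    where open ≡-Reasoning

  N-growth : ∀ k {a b} → m k ≤ a → a < b → (N k a + 2 * D a) * 2 ^ (Λ b ∸ Λ a) ≤ N k b
  N-growth k {a} {b} m≤a a<b = begin
    (N k a + 2 * D a) * 2 ^ δ                     ≡⟨ cong (_* 2 ^ δ) (N+2D≡Sum k m≤a) ⟩
    Sum (suc a) (weight (m k) (Λ a)) * 2 ^ δ      ≡⟨ *-comm _ (2 ^ δ) ⟩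
    2 ^ δ * Sum (suc a) (weight (m k) (Λ a))      ≡⟨ sym (*-distribˡ-Sum (suc a) (2 ^ δ) _) ⟩
    Sum (suc a) (λ j → 2 ^ δ * weight (m k) (Λ a) j) ≡⟨ Sum-cong (suc a) rescale ⟩
    Sum (suc a) (weight (m k) (Λ b))              ≤⟨ Sum-monoˡ-≤ _ a<b ⟩
    N k b                                         ∎
    where
    open ≤-Reasoning
    δ = Λ b ∸ Λ a
    rescale : ∀ j → j < suc a → 2 ^ δ * weight (m k) (Λ a) j ≡ weight (m k) (Λ b) j
    rescale j j≤a = trans (*-comm (2 ^ δ) _)
                          (trans (weight-rescale (m k) (Λ a) δ j (≤-trans (n≤1+n _) (1+L≤Λ (≤-pred j≤a))))
                                 (cong (λ Λ′ → weight (m k) Λ′ j) (m+[n∸m]≡n (Λ-mono-≤ (<⇒≤ a<b)))))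

  tail-bound : ∀ e {i} Λ′ → tailIndex e ≤ i → (∀ j → j ≤ i → L j ≤ Λ′) →
               Sum (suc i) (weight (tailIndex e) Λ′) * 2 ^ e ≤ 2 ^ Λ′
  tail-bound e {i} Λ′ r≤i short = begin
    Sum (suc i) (weight r Λ′) * 2 ^ e                ≡⟨ cong (λ n → Sum n (weight r Λ′) * 2 ^ e) (sym r+n≡1+i) ⟩
    Sum (r + n) (weight r Λ′) * 2 ^ e                ≡⟨ cong (_* 2 ^ e) (Sum-leq≡sumFrom (scaledMass x Λ′) r n) ⟩
    sumFrom (scaledMass x Λ′) r n * 2 ^ e            ≡⟨ cong (sumFrom (scaledMass x Λ′) r n *_) (sym (suc[2^n∸1]≡2^n e)) ⟩
    sumFrom (scaledMass x Λ′) r n * suc (2 ^ e ∸ 1)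
      ≤⟨ partialSum≤⇒sumFrom≤ x Λ′ n r (2 ^ e ∸ 1) short′ (rate-bound 0 (2 ^ e ∸ 1) n) ⟩
    2 ^ Λ′                                           ∎
    where
    open ≤-Reasoning
    r = tailIndex e
    n = suc i ∸ r
    r+n≡1+i : r + n ≡ suc i
    r+n≡1+i = m+[n∸m]≡n (m≤n⇒m≤1+n r≤i)
    short′ : ∀ t → t < n → L (r + t) ≤ Λ′
    short′ t t<n = short (r + t) (≤-pred (subst (r + t <_) r+n≡1+i (+-monoʳ-< r t<n)))

  -- The single term 2^-(L i) of the tail is at most 2^-e.
  tailIndex≤⇒≤L : ∀ e {i} → tailIndex e ≤ i → e ≤ L i
  tailIndex≤⇒≤L e {i} r≤i =
    +-cancelˡ-≤ (Λ′ ∸ L i) e (L i) (subst (Λ′ ∸ L i + e ≤_) (sym (m∸n+n≡m (short i ≤-refl))) exponents)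
    where
    Λ′ = Λ i + e
    short : ∀ j → j ≤ i → L j ≤ Λ′
    short j j≤i = ≤-trans (<⇒≤ (1+L≤Λ j≤i)) (m≤m+n (Λ i) e)
    own-weight : 2 ^ (Λ′ ∸ L i) ≤ Sum (suc i) (weight (tailIndex e) Λ′)
    own-weight = subst (_≤ Sum (suc i) (weight (tailIndex e) Λ′)) (trans (cong (_* 2 ^ (Λ′ ∸ L i)) (leq-≤ r≤i)) (*-identityˡ _))
                       (term≤Sum (suc i) (weight (tailIndex e) Λ′) i ≤-refl)
    exponents : Λ′ ∸ L i + e ≤ Λ′
    exponents = ^-cancelʳ-≤ (subst (_≤ 2 ^ Λ′) (sym (^-distribˡ-+-* 2 (Λ′ ∸ L i) e))
                                   (≤-trans (*-monoˡ-≤ (2 ^ e) own-weight) (tail-bound e Λ′ r≤i short)))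

  3k≤5k : ∀ k → 3 * k ≤ 5 * k
  3k≤5k k = *-monoˡ-≤ k {3} {5} (s≤s (s≤s (s≤s z≤n)))

  3k≤L : ∀ k {i} → m k ≤ i → 3 * k ≤ L i
  3k≤L k m≤i = ≤-trans (3k≤5k k) (tailIndex≤⇒≤L (5 * k) m≤i)

  Λ≡gap+[ℓ+3k] : ∀ k {i} → m k ≤ i → Λ i ≡ gap i + (ℓ k i + 3 * k)
  Λ≡gap+[ℓ+3k] k {i} m≤i = trans (Λ≡gap+1+L i) (cong (gap i +_) (1+L≡ℓ+3k k i (3k≤L k m≤i)))

  -- Kraft's inequality for the lengths ℓ k i, i ≥ m k: the rounded-up mass
  -- below x_i stays under 2^-3k.
  V<2^ℓ : ∀ k {i} → m k ≤ i → V k i < 2 ^ ℓ k i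
  V<2^ℓ k {i} m≤i = *-cancelʳ-< (D i * 2 ^ (5 * k)) (V k i) (2 ^ ℓ k i) (begin-strict
    V k i * (D i * 2 ^ (5 * k))                    ≡⟨ sym (*-assoc (V k i) _ _) ⟩
    V k i * D i * 2 ^ (5 * k)                      <⟨ *-monoˡ-< (2 ^ (5 * k)) {{m^n≢0 2 (5 * k)}} (V*D<N+D k i) ⟩
    (N k i + D i) * 2 ^ (5 * k)                    ≤⟨ *-monoˡ-≤ (2 ^ (5 * k)) (+-monoʳ-≤ (N k i) (m≤m+n (D i) _)) ⟩
    (N k i + 2 * D i) * 2 ^ (5 * k)                ≡⟨ cong (_* 2 ^ (5 * k)) (N+2D≡Sum k m≤i) ⟩
    Sum (suc i) (weight (m k) (Λ i)) * 2 ^ (5 * k) ≤⟨ tail-bound (5 * k) (Λ i) m≤i (λ j j≤i → <⇒≤ (1+L≤Λ j≤i)) ⟩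
    2 ^ Λ i                                        ≡⟨ cong (2 ^_) (Λ≡gap+[ℓ+3k] k m≤i) ⟩
    2 ^ (gap i + (ℓ k i + 3 * k))                  ≤⟨ ^-monoʳ-≤ 2 (+-monoʳ-≤ (gap i) (+-monoʳ-≤ (ℓ k i) (3k≤5k k))) ⟩
    2 ^ (gap i + (ℓ k i + 5 * k))                  ≡⟨ split (gap i) (ℓ k i) (5 * k) ⟩
    2 ^ ℓ k i * (D i * 2 ^ (5 * k))                ∎)
    where
    open ≤-Reasoning
    split : ∀ g l e → 2 ^ (g + (l + e)) ≡ 2 ^ l * (2 ^ g * 2 ^ e)
    split g l e = begin-equality
      2 ^ (g + (l + e))        ≡⟨ cong (2 ^_) (rearrange g l e) ⟩
      2 ^ (l + (g + e))        ≡⟨ ^-distribˡ-+-* 2 l (g + e) ⟩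
      2 ^ l * 2 ^ (g + e)      ≡⟨ cong (2 ^ l *_) (^-distribˡ-+-* 2 g e) ⟩
      2 ^ l * (2 ^ g * 2 ^ e)  ∎
      where
      rearrange : ∀ g l e → g + (l + e) ≡ l + (g + e)
      rearrange = solve-∀

  -- In units 2^-Λ b, the interval of codeword k a ends before that of codeword k b starts.
  interval-before : ∀ k {a b} → m k ≤ a → a < b → suc (V k a) * (D a * 2 ^ (Λ b ∸ Λ a)) < V k b * D b
  interval-before k {a} {b} m≤a a<b = begin-strict
    suc (V k a) * (D a * 2 ^ δ)        ≡⟨ rearrange (V k a) (D a) (2 ^ δ) ⟩
    (V k a * D a + D a) * 2 ^ δ        <⟨ *-monoˡ-< (2 ^ δ) {{m^n≢0 2 δ}} (+-monoˡ-< (D a) (V*D<N+D k a)) ⟩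
    (N k a + D a + D a) * 2 ^ δ        ≡⟨ cong (_* 2 ^ δ) (rearrange′ (N k a) (D a)) ⟩
    (N k a + 2 * D a) * 2 ^ δ          ≤⟨ N-growth k m≤a a<b ⟩
    N k b                              ≤⟨ N≤V*D k b ⟩
    V k b * D b                        ∎
    where
    open ≤-Reasoning
    δ = Λ b ∸ Λ a
    rearrange : ∀ v d p → suc v * (d * p) ≡ (v * d + d) * p
    rearrange = solve-∀
    rearrange′ : ∀ n d → n + d + d ≡ n + 2 * d
    rearrange′ = solve-∀

  exponents : ∀ k {a b} → m k ≤ a → a ≤ b → gap a + (Λ b ∸ Λ a) + ℓ k a ≡ gap b + ℓ k b
  exponents k {a} {b} m≤a a≤b = +-cancelʳ-≡ (3 * k) _ _ (begin
    gap a + δ + ℓ k a + 3 * k    ≡⟨ rearrange (gap a) δ (ℓ k a) (3 * k) ⟩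
    gap a + (ℓ k a + 3 * k) + δ  ≡⟨ cong (_+ δ) (sym (Λ≡gap+[ℓ+3k] k m≤a)) ⟩
    Λ a + δ                      ≡⟨ m+[n∸m]≡n (Λ-mono-≤ a≤b) ⟩
    Λ b                          ≡⟨ Λ≡gap+[ℓ+3k] k (≤-trans m≤a a≤b) ⟩
    gap b + (ℓ k b + 3 * k)      ≡⟨ sym (+-assoc (gap b) (ℓ k b) (3 * k)) ⟩
    gap b + ℓ k b + 3 * k        ∎)
    where
    open ≡-Reasoning
    δ = Λ b ∸ Λ a
    rearrange : ∀ g δ l t → g + δ + l + t ≡ g + (l + t) + δ
    rearrange = solve-∀

  codeword-⊑ : ∀ k {i j} → m k ≤ i → m k ≤ j → codeword k i ⊑ codeword k j →
               ℓ k i + (ℓ k j ∸ ℓ k i) ≡ ℓ k j × V k i ≡ V k j /2^ (ℓ k j ∸ ℓ k i)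
  codeword-⊑ k {i} {j} m≤i m≤j pre =
    ℓ≡ , bits-⊑ (ℓ k i) d (V<2^ℓ k m≤i) V<2^ℓ+d (subst (λ l → codeword k i ⊑ bits l (V k j)) (sym ℓ≡) pre)
    where
    d = ℓ k j ∸ ℓ k i
    ℓ≡ : ℓ k i + d ≡ ℓ k j
    ℓ≡ = m+[n∸m]≡n (subst₂ _≤_ (length-bits (ℓ k i) (V k i)) (length-bits (ℓ k j) (V k j)) (⊑⇒length≤ pre))
    V<2^ℓ+d : V k j < 2 ^ (ℓ k i + d)
    V<2^ℓ+d = subst (λ l → V k j < 2 ^ l) (sym ℓ≡) (V<2^ℓ k m≤j)

  codeword-not-⊑-later : ∀ k {a b} → m k ≤ a → a < b → ¬ (codeword k a ⊑ codeword k b)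
  codeword-not-⊑-later k {a} {b} m≤a a<b pre = <-asym (interval-before k m≤a a<b) (begin-strict
    V k b * D b                       <⟨ *-monoˡ-< (D b) {{pow2-nonZero (gap b)}} V<[1+V]*2^d ⟩
    suc (V k a) * 2 ^ d * D b         ≡⟨ *-assoc (suc (V k a)) (2 ^ d) (D b) ⟩
    suc (V k a) * (2 ^ d * D b)       ≡⟨ cong (suc (V k a) *_) units ⟩
    suc (V k a) * (D a * 2 ^ δ)       ∎)
    where
    open ≤-Reasoning
    δ = Λ b ∸ Λ a
    d = ℓ k b ∸ ℓ k a
    lined-up : ℓ k a + d ≡ ℓ k b × V k a ≡ V k b /2^ d
    lined-up = codeword-⊑ k m≤a (≤-trans m≤a (<⇒≤ a<b)) pre
    V<[1+V]*2^d : V k b < suc (V k a) * 2 ^ d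
    V<[1+V]*2^d = subst (λ v → V k b < suc v * 2 ^ d) (sym (proj₂ lined-up)) (m<[1+m/2^d]*2^d (V k b) d)
    gaps : gap a + δ ≡ gap b + d
    gaps = +-cancelʳ-≡ (ℓ k a) _ _ (trans (exponents k m≤a (<⇒≤ a<b))
                                          (trans (cong (gap b +_) (sym (proj₁ lined-up))) (rearrange (gap b) (ℓ k a) d)))
      where
      rearrange : ∀ g l d → g + (l + d) ≡ g + d + l
      rearrange = solve-∀
    units : 2 ^ d * D b ≡ D a * 2 ^ δ
    units = trans (*-comm (2 ^ d) (D b)) (trans (sym (^-distribˡ-+-* 2 (gap b) d))
                  (trans (cong (2 ^_) (sym gaps)) (^-distribˡ-+-* 2 (gap a) δ)))

  codeword-not-⊑-earlier : ∀ k {a b} → m k ≤ a → a < b → ¬ (codeword k b ⊑ codeword k a)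
  codeword-not-⊑-earlier k {a} {b} m≤a a<b pre = <-asym (interval-before k m≤a a<b) (begin-strict
    V k b * D b                       ≡⟨ cong (V k b *_) units ⟩
    V k b * (2 ^ d * (D a * 2 ^ δ))   ≡⟨ sym (*-assoc (V k b) (2 ^ d) _) ⟩
    V k b * 2 ^ d * (D a * 2 ^ δ)     ≤⟨ *-monoˡ-≤ (D a * 2 ^ δ) V*2^d≤V ⟩
    V k a * (D a * 2 ^ δ)             <⟨ *-monoˡ-< (D a * 2 ^ δ) {{unit≢0}} (n<1+n (V k a)) ⟩
    suc (V k a) * (D a * 2 ^ δ)       ∎)
    where
    open ≤-Reasoning
    δ = Λ b ∸ Λ a
    d = ℓ k a ∸ ℓ k b
    unit≢0 : NonZero (D a * 2 ^ δ)
    unit≢0 = m*n≢0 (D a) (2 ^ δ) {{pow2-nonZero (gap a)}} {{pow2-nonZero δ}}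
    lined-up : ℓ k b + d ≡ ℓ k a × V k b ≡ V k a /2^ d
    lined-up = codeword-⊑ k (≤-trans m≤a (<⇒≤ a<b)) m≤a pre
    V*2^d≤V : V k b * 2 ^ d ≤ V k a
    V*2^d≤V = subst (λ v → v * 2 ^ d ≤ V k a) (sym (proj₂ lined-up)) (m/n*n≤m (V k a) (2 ^ d) {{pow2-nonZero d}})
    gaps : gap a + δ + d ≡ gap b
    gaps = +-cancelʳ-≡ (ℓ k b) _ _ (trans (rearrange (gap a) δ d (ℓ k b))
                                          (trans (cong (gap a + δ +_) (proj₁ lined-up)) (exponents k m≤a (<⇒≤ a<b))))
      where
      rearrange : ∀ g δ d l → g + δ + d + l ≡ g + δ + (l + d)
      rearrange = solve-∀
    units : D b ≡ 2 ^ d * (D a * 2 ^ δ)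
    units = trans (cong (2 ^_) (sym gaps)) (trans (^-distribˡ-+-* 2 (gap a + δ) d)
                  (trans (*-comm _ (2 ^ d)) (cong (2 ^ d *_) (^-distribˡ-+-* 2 (gap a) δ))))

  program-⊑ : ∀ {k i k′ i′} → m k ≤ i → m k′ ≤ i′ → program k i ⊑ program k′ i′ → k ≡ k′ × i ≡ i′
  program-⊑ {k} {i} {k′} {i′} m≤i m≤i′ pre with unary-header-⊑ k k′ pre
  ... | refl , cw⊑ with <-cmp i i′
  ...   | tri< i<i′ _ _ = ⊥-elim (codeword-not-⊑-later k m≤i i<i′ cw⊑)
  ...   | tri≈ _ i≡i′ _ = refl , i≡i′
  ...   | tri> _ _ i>i′ = ⊥-elim (codeword-not-⊑-earlier k m≤i′ i>i′ cw⊑)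

  encodeXExp : ∀ {n} → Exp n → Exp n
  encodeXExp = external₁ (λ i → encode (x i)) x-comp

  LExp : ∀ {n} → Exp n → Exp n
  LExp = apply₁ L (LengthOfCode (encodeXExp v₀)) (λ i → lengthOfCode-encode (x i))

  mExp : ∀ {n} → Exp n → Exp n
  mExp = apply₁ m (external₂ rate rate-comp zro (Pow2 (lit 5 ⊗ v₀) ⊖ lit 1)) (λ k → refl)

  ΛExp : ∀ {n} → Exp n → Exp n
  ΛExp = apply₁ Λ (sum (Suc v₀) (Suc (LExp v₀))) (λ i → refl)

  NExp : ∀ {n} → Exp n → Exp n → Exp n
  NExp = apply₂ N (sum v₁ (Leq (mExp v₁) v₀ ⊗ Pow2 (ΛExp v₂ ⊖ LExp v₀))) (λ k i → refl)

  gapExp : ∀ {n} → Exp n → Exp n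
  gapExp = apply₁ gap (ΛExp v₀ ⊖ Suc (LExp v₀)) (λ i → refl)

  VExp : ∀ {n} → Exp n → Exp n → Exp n
  VExp = apply₂ V (Div2^ (NExp v₀ v₁ ⊕ Pow2 (gapExp v₁) ⊖ lit 1) (gapExp v₁)) (λ k i → refl)

  ℓExp : ∀ {n} → Exp n → Exp n → Exp n
  ℓExp = apply₂ ℓ (Suc (LExp v₁) ⊖ lit 3 ⊗ v₀) (λ k i → refl)

  programCodeExp : ∀ {n} → Exp n → Exp n → Exp n
  programCodeExp = apply₂ (λ k i → encode (program k i))
                       (rec (Suc (lit 2 ⊗ EncodeBits (ℓExp v₀ v₁) (VExp v₀ v₁))) (Suc (Suc (lit 2 ⊗ v₁))) v₀)
                       (λ k i → encode-replicate-true-++ k (false ∷ codeword k i))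

  -- Agrees with encode (take s (x i)) only for s ≤ L i.
  prefixCode : ℕ → ℕ → ℕ
  prefixCode i s = (2 ^ s ∸ 1) + suc (encode (x i)) %2^ s

  prefixCodeExp : ∀ {n} → Exp n → Exp n → Exp n
  prefixCodeExp = apply₂ prefixCode ((Pow2 v₁ ⊖ lit 1) ⊕ Mod2^ (Suc (encodeXExp v₀)) v₁) (λ i s → refl)

  mismatch : ℕ → ℕ → ℕ → ℕ → ℕ
  mismatch z k i s = (m k ∸ i) + (s ∸ L i) + ∣ z - pair (encode (program k i)) (prefixCode i s) ∣

  -- On (t , z) it is 0 iff mismatch z k i s ≡ 0 for some k, i, s < t.
  searchExp : Exp 2
  searchExp = IsZero (sum v₀ (sum v₁ (sum v₂ (IsZero
             ((mExp v₂ ⊖ v₁) ⊕ (v₀ ⊖ LExp v₁) ⊕ Dist v₄ (Pair (programCodeExp v₂ v₁) (prefixCodeExp v₁ v₀)))))))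

  search-sound : ∀ t z → ⟦ searchExp ⟧ (t ∷ z ∷ []) ≡ 0 → Σ ℕ λ k → Σ ℕ λ i → Σ ℕ λ s → mismatch z k i s ≡ 0
  search-sound t z found =
    let k , _ , found-k = Sum>0⇒term>0 t _ (isZero≡0⇒>0 _ found)
        i , _ , found-i = Sum>0⇒term>0 t _ found-k
        s , _ , found-s = Sum>0⇒term>0 t _ found-i
    in k , i , s , isZero>0⇒≡0 _ found-s

  search-complete : ∀ {z} k i s → mismatch z k i s ≡ 0 → ⟦ searchExp ⟧ (suc (k + i + s) ∷ z ∷ []) ≡ 0
  search-complete {z} k i s mismatch≡0 = >0⇒isZero≡0 (<-≤-trans (<-≤-trans (<-≤-trans
      (subst (λ a → 0 < isZero a) (sym mismatch≡0) z<s)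
      (term≤Sum t (λ s → isZero (mismatch z k i s)) s s<t))
      (term≤Sum t (λ i → Sum t (λ s → isZero (mismatch z k i s))) i i<t))
      (term≤Sum t (λ k → Sum t (λ i → Sum t (λ s → isZero (mismatch z k i s)))) k k<t))
    where
    t = suc (k + i + s)
    k<t : k < t
    k<t = s≤s (≤-trans (m≤m+n k i) (m≤m+n (k + i) s))
    i<t : i < t
    i<t = s≤s (≤-trans (m≤n+m i k) (m≤m+n (k + i) s))
    s<t : s < t
    s<t = s≤s (m≤n+m s (k + i))

  prefixCode≡encode-take : ∀ {i s} → s ≤ L i → prefixCode i s ≡ encode (take s (x i))
  prefixCode≡encode-take {i} {s} s≤L = sym (encode-take (x i) s s≤L)

  pairCode : Str → Str → ℕ
  pairCode p y = pair (encode p) (encode y)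

  mismatch≡0⇒ : ∀ {z} k i s → mismatch z k i s ≡ 0 → m k ≤ i × s ≤ L i × z ≡ pairCode (program k i) (take s (x i))
  mismatch≡0⇒ {z} k i s eq =
    m≤i , s≤L , trans (∣m-n∣≡0⇒m≡n dist≡0) (cong (pair (encode (program k i))) (prefixCode≡encode-take s≤L))
    where
    front : (m k ∸ i) + (s ∸ L i) ≡ 0
    front = m+n≡0⇒m≡0 _ eq
    dist≡0 : ∣ z - pair (encode (program k i)) (prefixCode i s) ∣ ≡ 0
    dist≡0 = m+n≡0⇒n≡0 ((m k ∸ i) + (s ∸ L i)) eq
    m≤i : m k ≤ i
    m≤i = m∸n≡0⇒m≤n (m+n≡0⇒m≡0 _ front)
    s≤L : s ≤ L i
    s≤L = m∸n≡0⇒m≤n (m+n≡0⇒n≡0 (m k ∸ i) front)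

  mismatch-code : ∀ k {i s} → m k ≤ i → s ≤ L i → mismatch (pairCode (program k i) (take s (x i))) k i s ≡ 0
  mismatch-code k {i} {s} m≤i s≤L
    rewrite m≤n⇒m∸n≡0 m≤i | m≤n⇒m∸n≡0 s≤L | prefixCode≡encode-take s≤L =
    ∣n-n∣≡0 (pairCode (program k i) (take s (x i)))

  decoder : PR 1
  decoder = mu (compile searchExp)

  data _↦_ : Str → Str → Set where
    decodes : ∀ {k i s} → m k ≤ i → s ≤ L i → program k i ↦ take s (x i)

  mismatch≡0⇒↦ : ∀ {p y} k i s → mismatch (pairCode p y) k i s ≡ 0 → p ↦ y
  mismatch≡0⇒↦ k i s eq =
    let m≤i , s≤L , code≡ = mismatch≡0⇒ k i s eq
        p≡ , y≡ = pair-injective _ _ (encode (program k i)) (encode (take s (x i))) code≡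
    in subst₂ _↦_ (sym (encode-injective _ _ p≡)) (sym (encode-injective _ _ y≡)) (decodes {k} {i} {s} m≤i s≤L)

  ∈decoder⇒↦ : ∀ {p y} → (p , y) ∈D decoder → p ↦ y
  ∈decoder⇒↦ {p} {y} (v , halts) =
    let k , i , s , eq = search-sound v (pairCode p y) (mu-zero searchExp halts) in mismatch≡0⇒↦ k i s eq

  ↦⇒∈decoder : ∀ {p y} → p ↦ y → (p , y) ∈D decoder
  ↦⇒∈decoder (decodes {k} {i} {s} m≤i s≤L) =
    mu-halts searchExp (z ∷ []) (suc (k + i + s)) (search-complete {z} k i s (mismatch-code k m≤i s≤L))
    where
    z = pairCode (program k i) (take s (x i))

  ↦-consistent : ∀ {p y p′ y′} → p ↦ y → p′ ↦ y′ → p ⊑ p′ → Comparable y y′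
  ↦-consistent (decodes {s = s} m≤i _) (decodes {s = s′} m≤i′ _) pre with program-⊑ m≤i m≤i′ pre
  ... | refl , refl = take-comparable s s′ _

  ↦-downward : ∀ {p y y′} → p ↦ y → y′ ⊑ y → p ↦ y′
  ↦-downward (decodes {i = i} {s = s} m≤i s≤L) y′⊑ =
    subst (_ ↦_) (sym (⊑⇒≡take (⊑-trans y′⊑ (take-⊑ s (x i)))))
          (decodes m≤i (≤-trans (⊑⇒length≤ y′⊑) (≤-trans (length-take≤ s (x i)) s≤L)))
    where
    length-take≤ : ∀ s (w : Str) → length (take s w) ≤ s
    length-take≤ s w = subst (_≤ s) (sym (length-take s w)) (m⊓n≤m s (length w))

  decoderMonotone : MonotoneDecoder
  decoderMonotone = record
    { code       = decoder
    ; consistent = λ {p} {y} {p′} {y′} p↦y p′↦y′ →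
                     ↦-consistent (∈decoder⇒↦ {p} {y} p↦y) (∈decoder⇒↦ {p′} {y′} p′↦y′)
    ; downward   = λ {p} {y} {y′} p↦y y′⊑y → ↦⇒∈decoder {p} {y′} (↦-downward (∈decoder⇒↦ {p} {y} p↦y) y′⊑y)
    }

  Km-program : ∀ k {i} → m k ≤ i → KmLe decoderMonotone (x i) (length (program k i))
  Km-program k {i} m≤i =
    program k i , ≤-refl , program k i , x i , ⊑-refl _ ,
    ↦⇒∈decoder (subst (program k i ↦_) (take-all (L i) (x i) ≤-refl) (decodes m≤i ≤-refl)) , ⊑-refl _

  length-program : ∀ k {i} → m k ≤ i → length (program k i) + 2 * k ≡ 2 + L i
  length-program k {i} m≤i = begin
    length (program k i) + 2 * k   ≡⟨ cong (_+ 2 * k) length≡ ⟩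
    k + suc (ℓ k i) + 2 * k        ≡⟨ rearrange k (ℓ k i) ⟩
    suc (ℓ k i + 3 * k)            ≡⟨ cong suc (sym (1+L≡ℓ+3k k i (3k≤L k m≤i))) ⟩
    2 + L i                        ∎
    where
    open ≡-Reasoning
    length≡ : length (program k i) ≡ k + suc (ℓ k i)
    length≡ = trans (length-++ (replicate k true)) (cong₂ (λ a b → a + suc b) (length-replicate k) (length-bits (ℓ k i) (V k i)))
    rearrange : ∀ k l → k + suc l + 2 * k ≡ suc (l + 3 * k)
    rearrange = solve-∀

  -- counted n k = 1 iff no x_i with i < m k has length n.
  counted : ℕ → ℕ → ℕ
  counted n k = isZero (Sum (m k) (λ i → isZero ∣ L i - n ∣))

  σ : ℕ → ℕ
  σ n = Sum n (counted n)

  σ-computable : Computable₁ σ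
  σ-computable = compile σExp , λ n → compile-correct σExp (n ∷ [])
    where
    σExp : Exp 1
    σExp = sum v₀ (IsZero (sum (mExp v₀) (IsZero (Dist (LExp v₀) v₂))))

  counted⇒m≤ : ∀ {n k i} → 0 < counted n k → L i ≡ n → m k ≤ i
  counted⇒m≤ {n} {k} {i} counted>0 L≡n with i <? m k
  ... | no i≮m  = ≮⇒≥ i≮m
  ... | yes i<m = contradiction (isZero>0⇒≡0 _ counted>0) (>⇒≢ (<-≤-trans own (term≤Sum (m k) _ i i<m)))
    where
    own : 0 < isZero ∣ L i - n ∣
    own = subst (λ d → 0 < isZero d) (sym (m≡n⇒∣m-n∣≡0 L≡n)) z<s

  n₀ : ℕ → ℕ
  n₀ B = suc (B + Sum B (λ k → Sum (m k) L))

  σ-large : ∀ B {n} → n₀ B ≤ n → B ≤ σ n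
  σ-large B {n} n₀≤n = begin
    B                     ≡⟨ sym (Sum-1 B) ⟩
    Sum B (λ _ → 1)       ≡⟨ Sum-cong B (λ k k<B → sym (all-counted k k<B)) ⟩
    Sum B (counted n)     ≤⟨ Sum-monoˡ-≤ (counted n) (≤-trans (m≤m+n B _) (<⇒≤ n₀≤n)) ⟩
    σ n                   ∎
    where
    open ≤-Reasoning
    L<n : ∀ k i → k < B → i < m k → L i < n
    L<n k i k<B i<m = <-≤-trans (s≤s (≤-trans (term≤Sum (m k) L i i<m)
                                     (≤-trans (term≤Sum B (λ k → Sum (m k) L) k k<B) (m≤n+m _ B)))) n₀≤n
    all-counted : ∀ k → k < B → counted n k ≡ 1
    all-counted k k<B =
      cong isZero (trans (Sum-cong (m k) (λ i i<m → >0⇒isZero≡0 (m<n⇒0<∣m-n∣ (L<n k i k<B i<m)))) (Sum-0 (m k)))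

  σ-unbounded : Unbounded σ
  σ-unbounded B = n₀ B , σ-large B ≤-refl

  σ≤1+last-counted : ∀ n → 0 < σ n → Σ ℕ λ k → k < n × 0 < counted n k × σ n ≤ suc k
  σ≤1+last-counted n = Sum-≤1+last n (counted n) (λ k → isZero≤1 (Sum (m k) (λ i → isZero ∣ L i - n ∣)))

k≤3+c : ∀ {n l s k c′ c} → n ≤ l + c′ + s + c → l + 2 * k ≡ 2 + n → s ≤ suc k → k ≤ 3 + (c′ + c)
k≤3+c {n} {l} {s} {k} {c′} {c} n≤ l+2k≡ s≤ = +-cancelʳ-≤ k k (3 + (c′ + c)) (+-cancelˡ-≤ n _ _ (begin
  n + (k + k)                    ≤⟨ +-monoˡ-≤ (k + k) n≤ ⟩
  l + c′ + s + c + (k + k)       ≡⟨ rearrange l c′ s c k ⟩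
  l + 2 * k + (s + (c′ + c))     ≡⟨ cong (_+ (s + (c′ + c))) l+2k≡ ⟩
  2 + n + (s + (c′ + c))         ≤⟨ +-monoʳ-≤ (2 + n) (+-monoˡ-≤ (c′ + c) s≤) ⟩
  2 + n + (suc k + (c′ + c))     ≡⟨ rearrange′ n k (c′ + c) ⟩
  n + (3 + (c′ + c) + k)         ∎))
  where
  open ≤-Reasoning
  rearrange : ∀ l c′ s c k → l + c′ + s + c + (k + k) ≡ l + 2 * k + (s + (c′ + c))
  rearrange = solve-∀
  rearrange′ : ∀ n k C → 2 + n + (suc k + C) ≡ n + (3 + C + k)
  rearrange′ = solve-∀

proposition4 : (U : MonotoneDecoder) → Optimal U →
    (T : TotalSolovayTest) →
    Σ (ℕ → ℕ) λ σ → Computable₁ σ × Unbounded σ ×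
      (∀ (ω : Seq) →
        (Σ ℕ λ c → ∀ n k → KmLe U (prefix ω n) k → n ≤ k + σ n + c) →
        Passes ω (TotalSolovayTest.x T))
proposition4 U optimal T = σ , σ-computable , σ-unbounded , passes
  where
  open TotalSolovayTest T
  open Construction T
  passes : ∀ ω → (Σ ℕ λ c → ∀ n k → KmLe U (prefix ω n) k → n ≤ k + σ n + c) → Passes ω x
  passes ω (c , Km≥) infinitely-often =
    let c′ , Km≤ = optimal decoderMonotone
        i , i≥ , hit = infinitely-often (tailIndex (n₀ (5 + (c′ + c))))
        B≤σ = σ-large (5 + (c′ + c)) (tailIndex≤⇒≤L (n₀ (5 + (c′ + c))) i≥)
        k , _ , counted>0 , σ≤1+k = σ≤1+last-counted (L i) (≤-trans z<s B≤σ)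
        m≤i = counted⇒m≤ {k = k} {i = i} counted>0 refl
        Km-ωⁿ = subst (λ w → KmLe U w (length (program k i) + c′)) (sym (prefix-length hit)) (Km≤ (x i) _ (Km-program k m≤i))
        k≤3+c′+c = k≤3+c {l = length (program k i)} (Km≥ (L i) _ Km-ωⁿ) (length-program k m≤i) σ≤1+k
    in <-irrefl refl (≤-trans (≤-pred (≤-trans B≤σ σ≤1+k)) k≤3+c′+c)
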